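{- Let $d$ be a positive integer, $w_1,w_2,\dots$ an infinite sequence of non-negative integers and $u$ a positive integer. Then the polynomials $s^w_\lambda(x)$, $\lambda\in\mathcal{P}(d)$, form a $\mathbb{Q}$-basis of $\mathbb{Q}[x]^{\mathfrak{S}_d}$.
   Context: $\mathcal{P}(d)$ is the set of partitions $\lambda=(\lambda_1\ge\dots\ge\lambda_d\ge0)$ with at most $d$ rows; put $\bar\lambda_i=\lambda_i+d+1-i$. $\mathbb{Q}[x]^{\mathfrak{S}_d}$ is the ring of symmetric polynomials in $x_1,\dots,x_d$ with rational coefficients. The factorial Schur polynomial in $x_1,\dots,x_d$ and indeterminates $a=(a_1,a_2,\dots)$ is $$s_\lambda(x|a)=\frac{\det\big[\prod_{p=1}^{\bar\lambda_i-1}(x_j-a_p)\big]_{1\le i,j\le d}}{\prod_{1\le i<j\le d}(x_i-x_j)}.$$ The twisted Schur polynomial $s^w_\lambda(x)\in\mathbb{Q}[x]^{\mathfrak{S}_d}$ is obtained from $s_\lambda(x|a)$ by substituting $a_l=-(w_l/u)(x_1+\dots+x_d)$ for all $l\ge1$. -}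

module Defs where

open import Algebra.Bundles using (CommutativeRing; Ring)
open import Algebra.Module.Bundles using (LeftModule)
open import Data.Fin.Base using (Fin; zero; suc; toℕ; punchIn)
open import Data.Fin.Permutation using (Permutation′; _⟨$⟩ʳ_)
import Data.Integer.Base as ℤ
open import Data.List.Base as List using (List; []; _∷_)
open import Data.Nat.Base as ℕ using (ℕ; zero; suc; _∸_; _≥_; NonZero)
open import Data.Product.Base using (Σ; ∃-syntax; _×_; _,_; proj₁)
open import Data.Rational.Base as ℚ using (ℚ; 0ℚ; 1ℚ)
import Data.Rational.Properties as ℚ
open import Data.Sum.Base using (_⊎_; inj₁; inj₂; [_,_]′)
open import Data.Vec.Base using (Vec; lookup)
open import Data.Vec.Relation.Unary.Linked using (Linked)
open import Function.Base using (_∘_)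
open import Function.Definitions using (Injective)
open import Level using (Level; _⊔_; 0ℓ)
open import Relation.Binary.PropositionalEquality.Core as ≡ using (_≡_)
open import Relation.Unary using (Pred)

private
  variable
    a c ℓ m ℓm p : Level

------------------------------------------------------------------------

-- b is a basis of the submodule of M carved out by the predicate S.

module _ {R : Ring c ℓ} (M : LeftModule R m ℓm) where
  open Ring R using (Carrier; _≈_; 0#)
  open LeftModule M using (Carrierᴹ; _≈ᴹ_; 0ᴹ; _*ₗ_; +ᴹ-monoid)
  open import Algebra.Properties.Monoid.Sum +ᴹ-monoid using (sum)

  record IsBasisOf {I : Set a} (S : Pred Carrierᴹ p) (b : I → Carrierᴹ) :
                   Set (a ⊔ c ⊔ ℓ ⊔ m ⊔ ℓm ⊔ p) where
    field
      membership  : ∀ i → S (b i)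
      independent : ∀ {n} (i : Fin n → I) → Injective _≡_ _≡_ i →
                    (k : Fin n → Carrier) →
                    sum (λ j → k j *ₗ b (i j)) ≈ᴹ 0ᴹ → ∀ j → k j ≈ 0#
      spanning    : ∀ v → S v →
                    ∃[ n ] Σ (Fin n → I) λ i → Σ (Fin n → Carrier) λ k →
                    v ≈ᴹ sum (λ j → k j *ₗ b (i j))

------------------------------------------------------------------------

module Bialternant (R : CommutativeRing c ℓ) where
  open CommutativeRing R hiding (zero)
  open import Algebra.Properties.Ring ring
    using (-0#≈0#; -‿involutive; -‿+-comm; -‿distribˡ-*; -‿distribʳ-*)
  open import Algebra.Properties.CommutativeSemigroup *-commutativeSemigroup
    using () renaming (x∙yz≈y∙xz to x*yz≈y*xz)
  open import Algebra.Properties.CommutativeSemigroup +-commutativeSemigroup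
    using () renaming (interchange to +-interchange)
  open import Algebra.Properties.Monoid.Sum +-monoid public using (sum)
  open import Algebra.Properties.Semiring.Sum semiring using (*-distribˡ-sum; sum-cong-≋)
  open import Algebra.Properties.Monoid.Sum *-monoid public using () renaming (sum to product)
  open import Algebra.Properties.Semiring.Exp semiring using (_^_)
  open import Relation.Binary.Reasoning.Setoid setoid

  -- Laplace expansion along the first column.
  det : ∀ {n} → (Fin n → Fin n → Carrier) → Carrier
  det {zero}  M = 1#
  det {suc n} M = sum λ i →
    (- 1#) ^ toℕ i * (M i zero * det λ r s → M (punchIn i r) (suc s))

  -- ∏_{i<j} (xᵢ - xⱼ), the factors with i = 0 split off first.
  vandermonde : ∀ {n} → (Fin n → Carrier) → Carrier
  vandermonde {zero}  x = 1#
  vandermonde {suc n} x = product (λ j → x zero - x (suc j)) * vandermonde (x ∘ suc)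

  -- factorialPower t y n = (y - t₁) ⋯ (y - tₙ), where tₗ₊₁ is `t l`.
  factorialPower : (ℕ → Carrier) → Carrier → ℕ → Carrier
  factorialPower t y n = product {n} λ l → y - t (toℕ l)

  -- The rest of this module shows that det [factorialPower t xⱼ eᵢ] is a
  -- multiple of the Vandermonde product.

  private
    variable
      A B : Set a

  -- Laplace expansion of the column v, for minors given by a function f
  -- of the list of remaining rows.
  expand : (A → Carrier) → (List A → Carrier) → List A → Carrier
  expand v f []       = 0#
  expand v f (r ∷ rs) = v r * f rs - expand v (f ∘ (r ∷_)) rs

  expand-cong : {v v′ : A → Carrier} {f g : List A → Carrier} →
                (∀ r → v r ≈ v′ r) → (∀ rs → f rs ≈ g rs) →
                ∀ rs → expand v f rs ≈ expand v′ g rs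
  expand-cong v≈ f≈ []       = refl
  expand-cong v≈ f≈ (r ∷ rs) =
    +-cong (*-cong (v≈ r) (f≈ rs)) (-‿cong (expand-cong v≈ (f≈ ∘ (r ∷_)) rs))

  expand-congʳ : (v : A → Carrier) {f g : List A → Carrier} →
                 (∀ rs → f rs ≈ g rs) → ∀ rs → expand v f rs ≈ expand v g rs
  expand-congʳ v = expand-cong {v = v} (λ _ → refl)

  +-sub : ∀ w x y z → (w + x) - (y + z) ≈ (w - y) + (x - z)
  +-sub w x y z = begin
    (w + x) + - (y + z)    ≈⟨ +-congˡ (-‿+-comm y z) ⟨
    (w + x) + (- y + - z)  ≈⟨ +-interchange w x (- y) (- z) ⟩
    (w - y) + (x - z)      ∎

  *-sub : ∀ k x y → k * x - k * y ≈ k * (x - y)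
  *-sub k x y = begin
    k * x + - (k * y)  ≈⟨ +-congˡ (-‿distribʳ-* k y) ⟩
    k * x + k * - y    ≈⟨ distribˡ k x (- y) ⟨
    k * (x - y)        ∎

  expand-+ʳ : (v : A → Carrier) (f g : List A → Carrier) → ∀ rs →
              expand v (λ rs → f rs + g rs) rs ≈ expand v f rs + expand v g rs
  expand-+ʳ v f g []       = sym (+-identityˡ 0#)
  expand-+ʳ v f g (r ∷ rs) =
    trans (+-cong (distribˡ _ _ _) (-‿cong (expand-+ʳ v _ _ rs))) (+-sub _ _ _ _)

  expand-*ʳ : ∀ k (v : A → Carrier) (f : List A → Carrier) → ∀ rs →
              expand v (λ rs → k * f rs) rs ≈ k * expand v f rs
  expand-*ʳ k v f []       = sym (zeroʳ k)
  expand-*ʳ k v f (r ∷ rs) =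
    trans (+-cong (x*yz≈y*xz _ _ _) (-‿cong (expand-*ʳ k v _ rs))) (*-sub k _ _)

  expand-+ˡ : (v v′ : A → Carrier) (f : List A → Carrier) → ∀ rs →
              expand (λ r → v r + v′ r) f rs ≈ expand v f rs + expand v′ f rs
  expand-+ˡ v v′ f []       = sym (+-identityˡ 0#)
  expand-+ˡ v v′ f (r ∷ rs) =
    trans (+-cong (distribʳ _ _ _) (-‿cong (expand-+ˡ v v′ _ rs))) (+-sub _ _ _ _)

  expand-*ˡ : ∀ k (v : A → Carrier) (f : List A → Carrier) → ∀ rs →
              expand (λ r → k * v r) f rs ≈ k * expand v f rs
  expand-*ˡ k v f []       = sym (zeroʳ k)
  expand-*ˡ k v f (r ∷ rs) =
    trans (+-cong (*-assoc _ _ _) (-‿cong (expand-*ˡ k v _ rs))) (*-sub k _ _)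

  expand-neg : (v : A → Carrier) (f : List A → Carrier) → ∀ rs →
               expand v (λ rs → - f rs) rs ≈ - expand v f rs
  expand-neg v f []       = sym -0#≈0#
  expand-neg v f (r ∷ rs) =
    trans (+-cong (sym (-‿distribʳ-* _ _)) (-‿cong (expand-neg v _ rs))) (-‿+-comm _ _)

  expand-sub : (v : A → Carrier) (f g : List A → Carrier) → ∀ rs →
               expand v (λ rs → f rs - g rs) rs ≈ expand v f rs - expand v g rs
  expand-sub v f g rs = trans (expand-+ʳ v f (-_ ∘ g) rs) (+-congˡ (expand-neg v g rs))

  neg-sub : ∀ x y → - (x - y) ≈ y - x
  neg-sub x y = begin
    - (x - y)    ≈⟨ -‿+-comm x (- y) ⟨
    - x + - - y  ≈⟨ +-congˡ (-‿involutive y) ⟩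
    - x + y      ≈⟨ +-comm (- x) y ⟩
    y - x        ∎

  expand² : (v v′ : A → Carrier) (f : List A → Carrier) → ∀ r rs →
            expand v (expand v′ f) (r ∷ rs) ≈
            (v r * expand v′ f rs - v′ r * expand v f rs)
              + expand v (expand v′ (f ∘ (r ∷_))) rs
  expand² v v′ f r rs = begin
    v r * expand v′ f rs - expand v (λ rs → v′ r * f rs - g rs) rs
      ≈⟨ +-congˡ (-‿cong (trans (expand-sub v _ g rs) (+-congʳ (expand-*ʳ _ v f rs)))) ⟩
    v r * expand v′ f rs - (v′ r * expand v f rs - expand v g rs)
      ≈⟨ +-congˡ (neg-sub _ _) ⟩
    v r * expand v′ f rs + (expand v g rs - v′ r * expand v f rs)
      ≈⟨ +-congˡ (+-comm _ _) ⟩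
    v r * expand v′ f rs + (- (v′ r * expand v f rs) + expand v g rs)
      ≈⟨ +-assoc _ _ _ ⟨
    (v r * expand v′ f rs - v′ r * expand v f rs) + expand v g rs ∎
    where g = expand v′ (f ∘ (r ∷_))

  expand-alternating : (v : A → Carrier) (f : List A → Carrier) → ∀ rs →
                       expand v (expand v f) rs ≈ 0#
  expand-alternating v f []       = refl
  expand-alternating v f (r ∷ rs) = trans (expand² v v f r rs)
    (trans (+-cong (-‿inverseʳ _) (expand-alternating v _ rs)) (+-identityˡ 0#))

  expand-anticomm : (v v′ : A → Carrier) (f : List A → Carrier) → ∀ rs →
                    expand v (expand v′ f) rs ≈ - expand v′ (expand v f) rs
  expand-anticomm v v′ f []       = sym -0#≈0#
  expand-anticomm v v′ f (r ∷ rs) = begin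
    expand v (expand v′ f) (r ∷ rs)
      ≈⟨ expand² v v′ f r rs ⟩
    (x - y) + expand v (expand v′ (f ∘ (r ∷_))) rs
      ≈⟨ +-cong (sym (neg-sub y x)) (expand-anticomm v v′ _ rs) ⟩
    - (y - x) + - expand v′ (expand v (f ∘ (r ∷_))) rs
      ≈⟨ -‿+-comm _ _ ⟩
    - ((y - x) + expand v′ (expand v (f ∘ (r ∷_))) rs)
      ≈⟨ -‿cong (expand² v′ v f r rs) ⟨
    - expand v′ (expand v f) (r ∷ rs) ∎
    where
    x = v r * expand v′ f rs
    y = v′ r * expand v f rs

  expand-map : (h : A → B) (v : B → Carrier) (f : List B → Carrier) → ∀ rs →
               expand (v ∘ h) (f ∘ List.map h) rs ≈ expand v f (List.map h rs)
  expand-map h v f []       = refl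
  expand-map h v f (r ∷ rs) = +-congˡ (-‿cong (expand-map h v (f ∘ (h r ∷_)) rs))

  columns : ∀ {n} → (Fin n → A → Carrier) → List A → Carrier
  columns {n = zero}  v rs = 1#
  columns {n = suc n} v rs = expand (v zero) (columns (v ∘ suc)) rs

  columns-map : ∀ {n} (h : A → B) (v : Fin n → B → Carrier) → ∀ rs →
                columns (λ j → v j ∘ h) rs ≈ columns v (List.map h rs)
  columns-map {n = zero}  h v rs = refl
  columns-map {n = suc n} h v rs =
    trans (expand-congʳ _ (columns-map h (v ∘ suc)) rs) (expand-map h _ _ rs)

  expand-tabulate : ∀ {n} (v : A → Carrier) (f : List A → Carrier) (r : Fin (suc n) → A) →
    expand v f (List.tabulate r) ≈
    sum λ i → (- 1#) ^ toℕ i * (v (r i) * f (List.tabulate (r ∘ punchIn i)))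
  expand-tabulate {n = zero}  v f r = +-cong (sym (*-identityˡ _)) -0#≈0#
  expand-tabulate {n = suc n} v f r = +-cong (sym (*-identityˡ _)) (begin
    - expand v (f ∘ (r zero ∷_)) (List.tabulate (r ∘ suc))
      ≈⟨ -‿cong (expand-tabulate v (f ∘ (r zero ∷_)) (r ∘ suc)) ⟩
    - sum t
      ≈⟨ -‿cong (*-identityˡ _) ⟨
    - (1# * sum t)
      ≈⟨ -‿distribˡ-* _ _ ⟩
    - 1# * sum t
      ≈⟨ *-distribˡ-sum (- 1#) t ⟩
    sum (λ i → - 1# * t i)
      ≈⟨ sum-cong-≋ (λ i → *-assoc (- 1#) ((- 1#) ^ toℕ i) (u i)) ⟨
    sum (λ i → (- 1#) ^ suc (toℕ i) * u i) ∎)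
    where
    u = λ i → v (r (suc i)) * f (r zero ∷ List.tabulate (r ∘ suc ∘ punchIn i))
    t = λ i → (- 1#) ^ toℕ i * u i

  det≈columns : ∀ {n} (v : Fin n → A → Carrier) (r : Fin n → A) →
                det (λ i j → v j (r i)) ≈ columns v (List.tabulate r)
  det≈columns {n = zero}  v r = refl
  det≈columns {n = suc n} v r = trans
    (sum-cong-≋ λ i → *-congˡ {(- 1#) ^ toℕ i}
      (*-congˡ {v zero (r i)} (det≈columns (v ∘ suc) (r ∘ punchIn i))))
    (sym (expand-tabulate (v zero) (columns (v ∘ suc)) r))

  -- Univariate polynomials in Newton form c₀ + (y - t₀)(c₁ + (y - t₁)(⋯)),
  -- given by the list of pairs (cₗ , tₗ).
  Newton : Set c
  Newton = List (Carrier × Carrier)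

  eval : Carrier → Newton → Carrier
  eval y []            = 0#
  eval y ((k , t) ∷ g) = k + (y - t) * eval y g

  difference : Carrier → Newton → Newton
  difference x []            = []
  difference x ((k , t) ∷ g) = (- eval x g , t) ∷ difference x g

  eval-difference : ∀ x y f → eval y f ≈ eval x f + (x - y) * eval y (difference x f)
  eval-difference x y []            =
    sym (trans (+-identityˡ _) (zeroʳ _))
  eval-difference x y ((k , t) ∷ g) = trans (+-congˡ lemma) (sym (+-assoc _ _ _))
    where
    G = eval x g
    H = eval y (difference x g)

    telescope : (x - t) - (x - y) ≈ y - t
    telescope = begin
      (x - t) - (x - y)    ≈⟨ +-sub x (- t) x (- y) ⟩
      (x - x) + (- t - - y) ≈⟨ +-cong (-‿inverseʳ x) (+-congˡ (-‿involutive y)) ⟩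
      0# + (- t + y)       ≈⟨ +-identityˡ _ ⟩
      - t + y              ≈⟨ +-comm _ _ ⟩
      y - t                ∎

    lemma : (y - t) * eval y g ≈ (x - t) * G + (x - y) * (- G + (y - t) * H)
    lemma = begin
      (y - t) * eval y g
        ≈⟨ *-congˡ (eval-difference x y g) ⟩
      (y - t) * (G + (x - y) * H)
        ≈⟨ distribˡ _ _ _ ⟩
      (y - t) * G + (y - t) * ((x - y) * H)
        ≈⟨ +-cong (*-congʳ telescope) (x*yz≈y*xz _ _ _) ⟨
      ((x - t) - (x - y)) * G + (x - y) * ((y - t) * H)
        ≈⟨ +-congʳ (distribʳ _ _ _) ⟩
      ((x - t) * G + - (x - y) * G) + (x - y) * ((y - t) * H)
        ≈⟨ +-congʳ (+-congˡ (trans (sym (-‿distribˡ-* _ _)) (-‿distribʳ-* _ _))) ⟩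
      ((x - t) * G + (x - y) * - G) + (x - y) * ((y - t) * H)
        ≈⟨ +-assoc _ _ _ ⟩
      (x - t) * G + ((x - y) * - G + (x - y) * ((y - t) * H))
        ≈⟨ +-congˡ (distribˡ _ _ _) ⟨
      (x - t) * G + (x - y) * (- G + (y - t) * H) ∎

  -- Subtracting the column of x from the columns of the yⱼ.
  expand-eval : ∀ {n} x (y : Fin n → Carrier) → ∀ rs →
    expand (eval x) (columns (eval ∘ y)) rs ≈
    expand (eval x) (λ rs → product (λ j → x - y j) *
                            columns (λ j → eval (y j) ∘ difference x) rs) rs
  expand-eval {n = zero}  x y = expand-congʳ _ λ _ → sym (*-identityˡ 1#)
  expand-eval {n = suc n} x y rs = begin
    expand e (expand e₀ D) rs
      ≈⟨ expand-anticomm e e₀ D rs ⟩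
    - expand e₀ (expand e D) rs
      ≈⟨ -‿cong (expand-congʳ e₀ (expand-eval x (y ∘ suc)) rs) ⟩
    - expand e₀ (expand e D′) rs
      ≈⟨ expand-anticomm e e₀ D′ rs ⟨
    expand e (expand e₀ D′) rs
      ≈⟨ expand-congʳ e (λ rs → trans
           (expand-cong {f = D′} (eval-difference x (y zero)) (λ _ → refl) rs)
           (expand-+ˡ e (λ r → k * e₁ r) D′ rs)) rs ⟩
    expand e (λ rs → expand e D′ rs + expand (λ r → k * e₁ r) D′ rs) rs
      ≈⟨ expand-+ʳ e _ _ rs ⟩
    expand e (expand e D′) rs + expand e (expand (λ r → k * e₁ r) D′) rs
      ≈⟨ trans (+-congʳ (expand-alternating e D′ rs)) (+-identityˡ _) ⟩
    expand e (expand (λ r → k * e₁ r) D′) rs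
      ≈⟨ expand-congʳ e (λ rs → trans (expand-*ˡ k e₁ D′ rs)
           (trans (*-congˡ (expand-*ʳ K e₁ E rs)) (sym (*-assoc _ _ _)))) rs ⟩
    expand e (λ rs → (k * K) * expand e₁ E rs) rs ∎
    where
    e  = eval x
    e₀ = eval (y zero)
    e₁ = eval (y zero) ∘ difference x
    k  = x - y zero
    K  = product (λ j → x - y (suc j))
    D  = columns (eval ∘ y ∘ suc)
    E  = columns (λ j → eval (y (suc j)) ∘ difference x)
    D′ = λ rs → K * E rs

  quotient : ∀ {n} → (Fin n → Carrier) → List Newton → Carrier
  quotient {zero}  x rs = 1#
  quotient {suc n} x rs =
    expand (eval (x zero)) (quotient (x ∘ suc) ∘ List.map (difference (x zero))) rs

  quotient-exact : ∀ {n} (x : Fin n → Carrier) → ∀ rs →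
                   columns (eval ∘ x) rs ≈ vandermonde x * quotient x rs
  quotient-exact {zero}  x rs = sym (*-identityˡ 1#)
  quotient-exact {suc n} x rs = begin
    expand e (columns (eval ∘ x ∘ suc)) rs
      ≈⟨ expand-eval (x zero) (x ∘ suc) rs ⟩
    expand e (λ rs → K * columns (λ j → eval (x (suc j)) ∘ h) rs) rs
      ≈⟨ expand-congʳ e (λ rs → trans
           (*-congˡ (trans (columns-map h (eval ∘ x ∘ suc) rs)
                           (quotient-exact (x ∘ suc) (List.map h rs))))
           (sym (*-assoc _ _ _))) rs ⟩
    expand e (λ rs → vandermonde x * quotient (x ∘ suc) (List.map h rs)) rs
      ≈⟨ expand-*ʳ (vandermonde x) e _ rs ⟩
    vandermonde x * quotient x rs ∎
    where
    e = eval (x zero)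
    h = difference (x zero)
    K = product (λ j → x zero - x (suc j))

  newton : (ℕ → Carrier) → ℕ → Newton
  newton t zero    = (1# , 0#) ∷ []
  newton t (suc n) = (0# , t 0) ∷ newton (t ∘ suc) n

  eval-newton : ∀ t y n → factorialPower t y n ≈ eval y (newton t n)
  eval-newton t y zero    = sym (trans (+-congˡ (zeroʳ _)) (+-identityʳ 1#))
  eval-newton t y (suc n) =
    trans (*-congˡ (eval-newton (t ∘ suc) y n)) (sym (+-identityˡ _))

  det-cong : ∀ {n} {M N : Fin n → Fin n → Carrier} → (∀ i j → M i j ≈ N i j) → det M ≈ det N
  det-cong {zero}  M≈N = refl
  det-cong {suc n} M≈N = sum-cong-≋ λ i → *-congˡ {(- 1#) ^ toℕ i}
    (*-cong (M≈N i zero) (det-cong λ r s → M≈N (punchIn i r) (suc s)))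

  bialternant : ∀ {n} (t : ℕ → Carrier) (x : Fin n → Carrier) (e : Fin n → ℕ) →
                Σ Carrier λ q → q * vandermonde x ≈ det λ i j → factorialPower t (x j) (e i)
  bialternant t x e = quotient x rows , (begin
    quotient x rows * vandermonde x                  ≈⟨ *-comm _ _ ⟩
    vandermonde x * quotient x rows                  ≈⟨ quotient-exact x rows ⟨
    columns (eval ∘ x) rows                          ≈⟨ det≈columns (eval ∘ x) (newton t ∘ e) ⟨
    det (λ i j → eval (x j) (newton t (e i)))        ≈⟨ det-cong (λ i j → eval-newton t (x j) (e i)) ⟨
    det (λ i j → factorialPower t (x j) (e i))       ∎)
    where rows = List.tabulate (newton t ∘ e)

------------------------------------------------------------------------

-- ℚ[V], presented as the free commutative ℚ-algebra on V: expressions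
-- modulo the congruence _≋_ generated by the laws of commutative
-- ℚ-algebras.  V may be infinite.

infixl 6 _⊕_
infixl 7 _⊗_
infix  4 _≋_

data Poly (V : Set) : Set where
  con : ℚ → Poly V
  var : V → Poly V
  _⊕_ : Poly V → Poly V → Poly V
  _⊗_ : Poly V → Poly V → Poly V

data _≋_ {V : Set} : Poly V → Poly V → Set where
  ≋-refl      : ∀ {f} → f ≋ f
  ≋-sym       : ∀ {f g} → f ≋ g → g ≋ f
  ≋-trans     : ∀ {f g h} → f ≋ g → g ≋ h → f ≋ h
  ⊕-cong      : ∀ {f f′ g g′} → f ≋ f′ → g ≋ g′ → f ⊕ g ≋ f′ ⊕ g′
  ⊗-cong      : ∀ {f f′ g g′} → f ≋ f′ → g ≋ g′ → f ⊗ g ≋ f′ ⊗ g′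
  ⊕-assoc     : ∀ f g h → (f ⊕ g) ⊕ h ≋ f ⊕ (g ⊕ h)
  ⊕-comm      : ∀ f g → f ⊕ g ≋ g ⊕ f
  ⊕-identityˡ : ∀ f → con 0ℚ ⊕ f ≋ f
  ⊗-assoc     : ∀ f g h → (f ⊗ g) ⊗ h ≋ f ⊗ (g ⊗ h)
  ⊗-comm      : ∀ f g → f ⊗ g ≋ g ⊗ f
  ⊗-identityˡ : ∀ f → con 1ℚ ⊗ f ≋ f
  ⊗-zeroˡ     : ∀ f → con 0ℚ ⊗ f ≋ con 0ℚ
  ⊗-distribˡ  : ∀ f g h → f ⊗ (g ⊕ h) ≋ f ⊗ g ⊕ f ⊗ h
  con-⊕       : ∀ a b → con (a ℚ.+ b) ≋ con a ⊕ con b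
  con-⊗       : ∀ a b → con (a ℚ.* b) ≋ con a ⊗ con b

infix 8 ⊖_

⊖_ : ∀ {V} → Poly V → Poly V
⊖ f = con (ℚ.- 1ℚ) ⊗ f

⊗-distribʳ : ∀ {V} (f g h : Poly V) → (g ⊕ h) ⊗ f ≋ g ⊗ f ⊕ h ⊗ f
⊗-distribʳ f g h = ≋-trans (⊗-comm _ _)
  (≋-trans (⊗-distribˡ f g h) (⊕-cong (⊗-comm _ _) (⊗-comm _ _)))

⊖-inverseˡ : ∀ {V} (f : Poly V) → ⊖ f ⊕ f ≋ con 0ℚ
⊖-inverseˡ f = ≋-trans (⊕-cong ≋-refl (≋-sym (⊗-identityˡ f)))
  (≋-trans (≋-sym (⊗-distribʳ f _ _))
  (≋-trans (⊗-cong (≋-sym (con-⊕ _ _)) ≋-refl) (⊗-zeroˡ f)))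

polyRing : Set → CommutativeRing 0ℓ 0ℓ
polyRing V = record
  { Carrier = Poly V
  ; _≈_     = _≋_
  ; _+_     = _⊕_
  ; _*_     = _⊗_
  ; -_      = ⊖_
  ; 0#      = con 0ℚ
  ; 1#      = con 1ℚ
  ; isCommutativeRing = record
    { isRing = record
      { +-isAbelianGroup = record
        { isGroup = record
          { isMonoid = record
            { isSemigroup = record
              { isMagma = record
                { isEquivalence = record
                  { refl = ≋-refl ; sym = ≋-sym ; trans = ≋-trans }
                ; ∙-cong = ⊕-cong
                }
              ; assoc = ⊕-assoc
              }
            ; identity = ⊕-identityˡ , λ f → ≋-trans (⊕-comm _ _) (⊕-identityˡ f)
            }
          ; inverse = ⊖-inverseˡ , λ f → ≋-trans (⊕-comm _ _) (⊖-inverseˡ f)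
          ; ⁻¹-cong = ⊗-cong ≋-refl
          }
        ; comm = ⊕-comm
        }
      ; *-cong     = ⊗-cong
      ; *-assoc    = ⊗-assoc
      ; *-identity = ⊗-identityˡ , λ f → ≋-trans (⊗-comm _ _) (⊗-identityˡ f)
      ; distrib    = ⊗-distribˡ , ⊗-distribʳ
      }
    ; *-comm = ⊗-comm
    }
  }

polyModule : Set → LeftModule ℚ.+-*-ring 0ℓ 0ℓ
polyModule V = record
  { Carrierᴹ = Poly V
  ; _≈ᴹ_     = _≋_
  ; _+ᴹ_     = _⊕_
  ; _*ₗ_     = λ k f → con k ⊗ f
  ; 0ᴹ       = con 0ℚ
  ; -ᴹ_      = ⊖_
  ; isLeftModule = record
    { isLeftSemimodule = record
      { +ᴹ-isCommutativeMonoid = P.+-isCommutativeMonoid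
      ; isPreleftSemimodule = record
        { *ₗ-cong      = λ { ≡.refl → ⊗-cong ≋-refl }
        ; *ₗ-zeroˡ     = ⊗-zeroˡ
        ; *ₗ-distribʳ  = λ f a b → ≋-trans (⊗-cong (con-⊕ a b) ≋-refl) (⊗-distribʳ f _ _)
        ; *ₗ-identityˡ = ⊗-identityˡ
        ; *ₗ-assoc     = λ a b f → ≋-trans (⊗-cong (con-⊗ a b) ≋-refl) (⊗-assoc _ _ f)
        ; *ₗ-zeroʳ     = λ a → P.zeroʳ (con a)
        ; *ₗ-distribˡ  = λ a → ⊗-distribˡ (con a)
        }
      }
    ; -ᴹ‿cong    = P.-‿cong
    ; -ᴹ‿inverse = P.-‿inverse
    }
  }
  where module P = CommutativeRing (polyRing V)

substitute : ∀ {V W} → (V → Poly W) → Poly V → Poly W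
substitute σ (con k) = con k
substitute σ (var v) = σ v
substitute σ (f ⊕ g) = substitute σ f ⊕ substitute σ g
substitute σ (f ⊗ g) = substitute σ f ⊗ substitute σ g

IsSymmetric : ∀ {d} → Pred (Poly (Fin d)) 0ℓ
IsSymmetric {d} f = ∀ (π : Permutation′ d) → substitute (λ i → var (π ⟨$⟩ʳ i)) f ≋ f

------------------------------------------------------------------------

-- Partitions with at most d rows.  The proof field is irrelevant, so
-- partitions with equal parts are equal.
record Partition (d : ℕ) : Set where
  field
    parts       : Vec ℕ d
    .decreasing : Linked _≥_ parts

open Partition public

-- λ̄ᵢ = λᵢ + d + 1 - i for 1 ≤ i ≤ d; the row index is `suc (toℕ i)`.
bar : ∀ {d} → Partition d → Fin d → ℕ
bar {d} μ i = lookup (parts μ) i ℕ.+ (suc d ∸ suc (toℕ i))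

-- The variable inj₁ i stands for xᵢ₊₁ and inj₂ l for aₗ₊₁.
module _ {d : ℕ} where
  open Bialternant (polyRing (Fin d ⊎ ℕ))

  -- The quotient of the two alternants; `bialternant` returns it together
  -- with the equation  quotient · vandermonde ≋ det  that characterises it
  -- (the Vandermonde product is not a zero divisor).
  factorialSchur : Partition d → Poly (Fin d ⊎ ℕ)
  factorialSchur μ =
    proj₁ (bialternant (var ∘ inj₂) (var ∘ inj₁) (λ i → bar μ i ∸ 1))

module _ {d : ℕ} (w : ℕ → ℕ) (u : ℕ) .{{_ : NonZero u}} where
  open Bialternant (polyRing (Fin d)) using (sum)

  -- `w l` is w_{l+1}.
  twistedSchur : Partition d → Poly (Fin d)
  twistedSchur μ = substitute
    [ var , (λ l → con (ℚ.- (ℤ.+ w l ℚ./ u)) ⊗ sum {d} var) ]′ (factorialSchur μ)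

{-# OPTIONS --safe #-}

module Submission where

-- Put cₗ = wₗ / u, e₁ = x₁ + ⋯ + x_d and, for n ∈ ℕᵈ, Nₙ = ∏ᵢ ∏_{l ≤ nᵢ} (xᵢ + cₗ e₁).
-- Summing (xᵢ + c_{nᵢ+1} e₁) Nₙ = N_{n+εᵢ} over i gives
-- (1 + Σᵢ c_{nᵢ+1}) e₁ Nₙ = Σᵢ N_{n+εᵢ}, where the first factor is positive because
-- w ≥ 0.  Hence multiplication by e₁ and by each xᵢ preserves the span of the Nₙ,
-- which is therefore all of ℚ[x]; and the formulas, read as definitions of operators on
-- formal combinations of the n ∈ ℕᵈ, are checked to commute, so that the Nₙ are a basis.
--
-- The twisted Schur polynomial of μ times the Vandermonde product is the alternant
-- det [N_{nᵢ}(xⱼ)] of the strictly decreasing n = μ + (d-1, …, 0).  Since e₁ is symmetric,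
-- permuting the variables permutes the Nₙ, so an alternating polynomial is determined
-- by its coefficients at strictly decreasing n, where the alternants have coefficients
-- δ.  Dividing by the Vandermonde product carries this basis of the alternating
-- polynomials to symmetric ones.

open import Algebra.Bundles using (CommutativeRing)
open import Data.Empty using (⊥-elim)
open import Data.Fin.Base using (Fin; zero; suc; punchIn; toℕ; fromℕ; inject₁)
import Data.Fin.Base as Fin using (_<_)
open import Data.Fin.Permutation as Perm using (Permutation′; _⟨$⟩ʳ_; lift₀; swap; remove)
import Data.Fin.Properties as Fin
import Data.Integer.Base as ℤ
open import Data.List.Base as List using (List; []; _∷_; _++_)
open import Data.List.Membership.Propositional using (_∈_)
open import Data.List.Membership.Propositional.Properties using (∈-deduplicate⁺)
open import Data.List.Relation.Unary.All as All using (All; []; _∷_)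
open import Data.List.Relation.Unary.Any using (here; there)
open import Data.List.Relation.Unary.Unique.DecPropositional.Properties using (deduplicate-!)
open import Data.List.Relation.Unary.Unique.Propositional using (Unique; []; _∷_)
open import Data.Nat.Base as ℕ using (ℕ; zero; suc; NonZero; _>_; _≥_; _∸_)
import Data.Nat.Properties as ℕ
open import Data.Product.Base using (∃; _×_; _,_; proj₁; proj₂)
open import Data.Rational.Base as ℚ using (ℚ; 0ℚ; 1ℚ; ½; _+_; _*_; _-_; -_)
import Data.Rational.Properties as ℚ
open import Data.Rational.Solver using (module +-*-Solver)
open import Data.Sum.Base using (_⊎_; inj₁; inj₂; [_,_]′)
open import Data.Vec.Base as Vec using (Vec; []; _∷_; lookup; updateAt; _[_]≔_)
open import Data.Vec.Properties
  using (≡-dec; updateAt-commutes; lookup∘updateAt; lookup∘updateAt′; updateAt-updateAt-local;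
         updateAt-id-local; updateAt-cong-local; lookup-replicate; lookup∘tabulate)
open import Data.Vec.Relation.Unary.Linked using (Linked; []; [-]; _∷_; linked?)
open import Data.Vec.Relation.Unary.Linked.Properties using (lookup⁺)
open import Function.Base using (_∘_; id)
open import Function.Definitions using (Injective)
open import Relation.Binary.Definitions using (tri<; tri≈; tri>)
open import Relation.Binary.PropositionalEquality
  using (_≡_; _≢_; _≗_; refl; sym; trans; cong; cong₂; module ≡-Reasoning)
open import Relation.Nullary using (Dec; yes; no; recompute)
open import Algebra.Properties.Semiring.Sum
  (CommutativeRing.semiring ℚ.+-*-commutativeRing)
  using (sum; sum-cong-≗; *-distribˡ-sum; ∑-distrib-+; sum-remove; sum-replicate-zero)

open import Defs
open +-*-Solver using (solve; _:+_; _:*_; _:-_; _:=_; :-_)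

-- Adjacent transpositions

adjacent : ∀ {n} → Fin n → Permutation′ (suc n)
adjacent {suc n} zero    = swap Perm.id
adjacent {suc n} (suc i) = lift₀ (adjacent i)

adjacent-involutive : ∀ {n} (i : Fin n) j → adjacent i ⟨$⟩ʳ (adjacent i ⟨$⟩ʳ j) ≡ j
adjacent-involutive zero    zero          = refl
adjacent-involutive zero    (suc zero)    = refl
adjacent-involutive zero    (suc (suc j)) = refl
adjacent-involutive (suc i) zero          = refl
adjacent-involutive (suc i) (suc j)       = cong suc (adjacent-involutive i j)

lift : ∀ {m n} → (Fin m → Fin n) → Fin (suc m) → Fin (suc n)
lift ρ zero    = zero
lift ρ (suc i) = suc (ρ i)

toFront : ∀ {n} → Fin (suc n) → Fin (suc n) → Fin (suc n)
toFront k zero    = k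
toFront k (suc j) = punchIn k j

-- Q speaks of functions up to pointwise equality rather than of permutations, so that `lift` and
-- `toFront` can be composed without constructing inverses.
record AdjacentClosed {n} (Q : (Fin (suc n) → Fin (suc n)) → Set) : Set where
  field
    resp : ∀ {ρ σ} → ρ ≗ σ → Q ρ → Q σ
    step : ∀ {ρ} i → Q ρ → Q (ρ ∘ (adjacent i ⟨$⟩ʳ_))

open AdjacentClosed

-- `lift ρ` precomposed with `adjacent (suc i)` is the lift of ρ precomposed with `adjacent i`; the
-- outer τ does not interfere with precomposition.
closed-lift : ∀ {n} {Q : (Fin (2 ℕ.+ n) → Fin (2 ℕ.+ n)) → Set} → AdjacentClosed Q →
              ∀ τ → AdjacentClosed (λ ρ → Q (τ ∘ lift ρ))
closed-lift cl τ .resp ρ≗σ = cl .resp λ where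
  zero    → refl
  (suc j) → cong (τ ∘ suc) (ρ≗σ j)
closed-lift cl τ .step i q = cl .resp (λ where
  zero    → refl
  (suc j) → refl) (cl .step (suc i) q)

-- Induction on k: `toFront (suc k)` is `lift (toFront k)` precomposed with the transposition of 0
-- and 1.
closed-toFront : ∀ {n} {Q : (Fin (suc n) → Fin (suc n)) → Set} →
                 AdjacentClosed Q → Q id → ∀ k → Q (toFront k)
closed-toFront cl q zero              = cl .resp (λ where
  zero    → refl
  (suc j) → refl) q
closed-toFront {suc n} cl q (suc k) = cl .resp (λ where
  zero          → refl
  (suc zero)    → refl
  (suc (suc j)) → refl)
  (cl .step zero (closed-toFront (closed-lift cl id) (cl .resp (λ where
    zero    → refl
    (suc j) → refl) q) k))

-- π is (toFront (π 0)) ∘ (a permutation fixing 0).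
adjacent-generate : ∀ {n} {Q : (Fin (suc n) → Fin (suc n)) → Set} →
                    AdjacentClosed Q → Q id → ∀ (π : Permutation′ (suc n)) → Q (π ⟨$⟩ʳ_)
adjacent-generate {zero} cl q π = cl .resp (unique (π ⟨$⟩ʳ_)) q
  where
  unique : (ρ : Fin 1 → Fin 1) → id ≗ ρ
  unique ρ zero with zero ← ρ zero = refl
adjacent-generate {suc n} {Q} cl q π = cl .resp (λ where
    zero    → refl
    (suc j) → sym (Perm.punchIn-permute π zero j))
  (adjacent-generate (closed-lift cl (toFront (π ⟨$⟩ʳ zero)))
    (cl .resp (λ where
      zero    → refl
      (suc j) → refl) (closed-toFront cl q (π ⟨$⟩ʳ zero)))
    (remove zero π))

-- Sorting exponent vectors by adjacent swaps

module _ {a} {A : Set a} where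

  swapAt : ∀ {n} → Fin n → Vec A (suc n) → Vec A (suc n)
  swapAt zero    (x ∷ y ∷ v) = y ∷ x ∷ v
  swapAt (suc i) (x ∷ v)     = x ∷ swapAt i v

  lookup-swapAt : ∀ {n} (i : Fin n) v j → lookup (swapAt i v) j ≡ lookup v (adjacent i ⟨$⟩ʳ j)
  lookup-swapAt zero    (x ∷ y ∷ v) zero          = refl
  lookup-swapAt zero    (x ∷ y ∷ v) (suc zero)    = refl
  lookup-swapAt zero    (x ∷ y ∷ v) (suc (suc j)) = refl
  lookup-swapAt (suc i) (x ∷ v)     zero          = refl
  lookup-swapAt (suc i) (x ∷ v)     (suc j)       = lookup-swapAt i v j

  swapAt-involutive : ∀ {n} (i : Fin n) v → swapAt i (swapAt i v) ≡ v
  swapAt-involutive zero    (x ∷ y ∷ v) = refl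
  swapAt-involutive (suc i) (x ∷ v)     = cong (x ∷_) (swapAt-involutive i v)

-- Modelled on the vanishing of an alternating function, which passes between v and its swaps and is
-- automatic where two neighbouring entries coincide.
record SwapClosed {n} (Q : Vec ℕ (suc n) → Set) : Set where
  field
    swapped : ∀ i v → Q (swapAt i v) → Q v
    fixed   : ∀ i v → swapAt i v ≡ v → Q v

open SwapClosed

swapClosed-∷ : ∀ {n} {Q : Vec ℕ (2 ℕ.+ n) → Set} → SwapClosed Q → ∀ x → SwapClosed (Q ∘ (x ∷_))
swapClosed-∷ cl x .swapped i v   = cl .swapped (suc i) (x ∷ v)
swapClosed-∷ cl x .fixed   i v p = cl .fixed (suc i) (x ∷ v) (cong (x ∷_) p)

-- The bound b is the entry that already stands in front of the vector, absorbed into Q. It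
-- guarantees that the sorted result continues a strictly decreasing vector.
insertion : ∀ {n} {Q : Vec ℕ (suc n) → Set} → SwapClosed Q →
            ∀ b → (∀ v → Linked _>_ (b ∷ v) → Q v) →
            ∀ x v → b > x → Linked _>_ (b ∷ v) → Q (x ∷ v)
insertion cl b sorted x []      b>x l = sorted _ (b>x ∷ [-])
insertion cl b sorted x (y ∷ v) b>x (b>y ∷ l) with ℕ.<-cmp x y
... | tri> _ _ x>y    = sorted _ (b>x ∷ x>y ∷ l)
... | tri≈ _ refl _ = cl .fixed zero _ refl
... | tri< x<y _ _    = cl .swapped zero _
  (insertion (swapClosed-∷ cl y) y (λ w l′ → sorted (y ∷ w) (b>y ∷ l′)) x v x<y l)

-- The tail is sorted first, with the head kept inside the predicate; then the head is inserted into
-- the sorted tail.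
bubbleSort : ∀ {n} {Q : Vec ℕ (suc n) → Set} → SwapClosed Q →
             (∀ v → Linked _>_ v → Q v) → ∀ v → Q v
bubbleSort {zero}  cl sorted (x ∷ []) = sorted _ [-]
bubbleSort {suc n} {Q} cl sorted (x ∷ v)  =
  bubbleSort {n} {Q ∘ (x ∷_)} (swapClosed-∷ cl x) (insert x) v
  where
  insert : ∀ x v → Linked _>_ v → Q (x ∷ v)
  insert x (y ∷ v) l with ℕ.<-cmp x y
  ... | tri> _ _ x>y    = sorted _ (x>y ∷ l)
  ... | tri≈ _ refl _ = cl .fixed zero _ refl
  ... | tri< x<y _ _    = cl .swapped zero _
    (insertion (swapClosed-∷ cl y) y (λ w → sorted (y ∷ w)) x v x<y l)

-- Sign change of determinants and Vandermonde products

module Alternation {V : Set} where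
  open Bialternant (polyRing V)
  open CommutativeRing (polyRing V)
    using (setoid; ring; *-commutativeMonoid; *-commutativeSemigroup; *-congˡ; *-congʳ; -‿cong)
  open import Algebra.Properties.Ring ring using (-‿distribˡ-*; -‿distribʳ-*)
  open import Algebra.Properties.CommutativeMonoid.Sum *-commutativeMonoid
    using () renaming (sum-permute to product-permute)
  open import Algebra.Properties.CommutativeSemigroup *-commutativeSemigroup using (x∙yz≈y∙xz)
  open import Relation.Binary.Reasoning.Setoid setoid

  -- Swapping neighbouring columns exchanges two nested Laplace expansions, and these anticommute.
  columns-adjacent : ∀ {A : Set} {n} (i : Fin n) (v : Fin (suc n) → A → Poly V) rs →
                     columns (v ∘ (adjacent i ⟨$⟩ʳ_)) rs ≋ ⊖ columns v rs
  columns-adjacent {n = suc n} zero    v rs =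
    expand-anticomm (v (suc zero)) (v zero) (columns {n = n} λ j → v (suc (suc j))) rs
  columns-adjacent {n = suc n} (suc i) v rs = ≋-trans
    (expand-congʳ (v zero) (columns-adjacent i (v ∘ suc)) rs)
    (expand-neg (v zero) (columns (v ∘ suc)) rs)

  det-adjacent : ∀ {n} (i : Fin n) (M : Fin (suc n) → Fin (suc n) → Poly V) →
                 det (λ r j → M r (adjacent i ⟨$⟩ʳ j)) ≋ ⊖ det M
  det-adjacent i M = begin
    det (λ r j → M r (adjacent i ⟨$⟩ʳ j))
      ≈⟨ det≈columns (λ j r → M r (adjacent i ⟨$⟩ʳ j)) id ⟩
    columns (λ j r → M r (adjacent i ⟨$⟩ʳ j)) (List.tabulate id)
      ≈⟨ columns-adjacent i (λ j r → M r j) (List.tabulate id) ⟩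
    ⊖ columns (λ j r → M r j) (List.tabulate id)
      ≈⟨ -‿cong (det≈columns (λ j r → M r j) id) ⟨
    ⊖ det M ∎

  swap-factors : ∀ p q r s t → (q ⊕ ⊖ p) ⊗ r ⊗ (s ⊗ t) ≋ ⊖ ((p ⊕ ⊖ q) ⊗ s ⊗ (r ⊗ t))
  swap-factors p q r s t = begin
    (q ⊕ ⊖ p) ⊗ r ⊗ (s ⊗ t)        ≈⟨ *-congʳ (*-congʳ (neg-sub p q)) ⟨
    (⊖ (p ⊕ ⊖ q)) ⊗ r ⊗ (s ⊗ t)    ≈⟨ ⊗-assoc _ _ _ ⟩
    (⊖ (p ⊕ ⊖ q)) ⊗ (r ⊗ (s ⊗ t))  ≈⟨ *-congˡ (x∙yz≈y∙xz r s t) ⟩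
    (⊖ (p ⊕ ⊖ q)) ⊗ (s ⊗ (r ⊗ t))  ≈⟨ -‿distribˡ-* _ _ ⟨
    ⊖ ((p ⊕ ⊖ q) ⊗ (s ⊗ (r ⊗ t)))  ≈⟨ -‿cong (⊗-assoc _ _ _) ⟨
    ⊖ ((p ⊕ ⊖ q) ⊗ s ⊗ (r ⊗ t))    ∎

  -- Swapping the first two variables negates their difference and exchanges the two products of
  -- their differences with the rest. A later swap only permutes the factors containing the first
  -- variable.
  vandermonde-adjacent : ∀ {n} (i : Fin n) (x : Fin (suc n) → Poly V) →
                         vandermonde (x ∘ (adjacent i ⟨$⟩ʳ_)) ≋ ⊖ vandermonde x
  vandermonde-adjacent {suc n} zero    x = swap-factors
    (x zero) (x (suc zero)) (product λ j → x (suc zero) ⊕ ⊖ x (suc (suc j)))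
    (product λ j → x zero ⊕ ⊖ x (suc (suc j))) (vandermonde λ j → x (suc (suc j)))
  vandermonde-adjacent {suc n} (suc i) x = begin
    product (λ j → x zero ⊕ ⊖ x (suc (adjacent i ⟨$⟩ʳ j))) ⊗ vandermonde (x ∘ suc ∘ (adjacent i ⟨$⟩ʳ_))
      ≈⟨ ⊗-cong (≋-sym (product-permute (λ j → x zero ⊕ ⊖ x (suc j)) (adjacent i)))
                (vandermonde-adjacent i (x ∘ suc)) ⟩
    product (λ j → x zero ⊕ ⊖ x (suc j)) ⊗ (⊖ vandermonde (x ∘ suc))
      ≈⟨ -‿distribʳ-* _ _ ⟨
    ⊖ vandermonde x ∎

-- Commuting operators on functionals

-1*≡- : ∀ x → - 1ℚ * x ≡ - x
-1*≡- x = trans (sym (ℚ.neg-distribˡ-* 1ℚ x)) (cong -_ (ℚ.*-identityˡ x))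

increment : ∀ {d} → Fin d → Vec ℕ d → Vec ℕ d
increment i v = updateAt v i suc

-- Only the increment at i itself alters the i-th entry, so the coefficient is constant apart from a
-- correction in one term.
sum-lookup-increment : ∀ {d} (c : ℕ → ℚ) (i : Fin d) v (t : Fin d → ℚ) →
  sum (λ j → c (lookup (increment j v) i) * t j) ≡
  c (lookup v i) * sum t + (c (suc (lookup v i)) - c (lookup v i)) * t i
sum-lookup-increment c zero    (x ∷ v) t =
  trans (cong (c (suc x) * t zero +_) (sym (*-distribˡ-sum (c x) (t ∘ suc))))
    (solve 4 (λ a b p q → a :* p :+ b :* q := b :* (p :+ q) :+ (a :- b) :* p) refl
      (c (suc x)) (c x) (t zero) (sum (t ∘ suc)))
sum-lookup-increment c (suc i) (x ∷ v) t =
  trans (cong (c (lookup v i) * t zero +_) (sum-lookup-increment c i v (t ∘ suc)))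
    (solve 5 (λ b p q a r → b :* p :+ (b :* q :+ (a :- b) :* r) := b :* (p :+ q) :+ (a :- b) :* r) refl
      (c (lookup v i)) (t zero) (sum (t ∘ suc)) (c (suc (lookup v i))) (t (suc i)))

total : ∀ {d} → (ℕ → ℚ) → Vec ℕ d → ℚ
total c v = sum (c ∘ lookup v)

total-increment : ∀ {d} (c : ℕ → ℚ) (i : Fin d) v →
  total c (increment i v) ≡ total c v + (c (suc (lookup v i)) - c (lookup v i))
total-increment c zero    (x ∷ v) =
  solve 3 (λ a b s → a :+ s := (b :+ s) :+ (a :- b)) refl (c (suc x)) (c x) (total c v)
total-increment c (suc i) (x ∷ v) =
  trans (cong (c x +_) (total-increment c i v)) (sym (ℚ.+-assoc (c x) _ _))

-- Polynomials act on functionals φ : Vec ℕ d → ℚ on the span of the Nₙ: Z and X i are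
-- the transposes of multiplication by e₁ and by xᵢ.  On all functions rather than on
-- finitely supported combinations, no bookkeeping of supports is needed.
module Operators {d : ℕ} (c : ℕ → ℚ) (κ : Vec ℕ d → ℚ)
  (κ-inverse : ∀ v → κ v * (1ℚ + total c v) ≡ 1ℚ) where

  private
    Φ = Vec ℕ d → ℚ
    variable φ ψ : Φ

  open ≡-Reasoning

  -- Read off from e₁ Nᵥ = κ(v) Σᵢ N_{v+εᵢ}; likewise `X` comes from xᵢ Nᵥ = N_{v+εᵢ} - c(vᵢ) e₁ Nᵥ.
  Z : Φ → Φ
  Z φ v = κ v * sum (λ i → φ (increment i v))

  X : Fin d → Φ → Φ
  X i φ v = φ (increment i v) - c (lookup v i) * Z φ v

  sum-increment : ∀ φ v → sum (λ i → φ (increment i v)) ≡ (1ℚ + total c v) * Z φ v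
  sum-increment φ v = begin
    s                           ≡⟨ ℚ.*-identityˡ s ⟨
    1ℚ * s                      ≡⟨ cong (_* s) (κ-inverse v) ⟨
    κ v * (1ℚ + total c v) * s  ≡⟨ solve 3 (λ k t s → k :* t :* s := t :* (k :* s)) refl
                                     (κ v) (1ℚ + total c v) s ⟩
    (1ℚ + total c v) * Z φ v    ∎
    where s = sum (λ i → φ (increment i v))

  Z-cong : φ ≗ ψ → Z φ ≗ Z ψ
  Z-cong φ≗ψ v = cong (κ v *_) (sum-cong-≗ λ i → φ≗ψ (increment i v))

  X-cong : ∀ i → φ ≗ ψ → X i φ ≗ X i ψ
  X-cong i φ≗ψ v = cong₂ (λ x z → x - c (lookup v i) * z) (φ≗ψ _) (Z-cong φ≗ψ v)

  Z-+ : ∀ φ ψ v → Z (λ v → φ v + ψ v) v ≡ Z φ v + Z ψ v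
  Z-+ φ ψ v = trans (cong (κ v *_) (∑-distrib-+ (λ i → φ (increment i v)) (λ i → ψ (increment i v))))
    (ℚ.*-distribˡ-+ (κ v) _ _)

  X-+ : ∀ i φ ψ v → X i (λ v → φ v + ψ v) v ≡ X i φ v + X i ψ v
  X-+ i φ ψ v = trans (cong (λ z → φ (increment i v) + ψ (increment i v) - c (lookup v i) * z) (Z-+ φ ψ v))
    (solve 5 (λ x y k z w → (x :+ y) :- k :* (z :+ w) := (x :- k :* z) :+ (y :- k :* w)) refl
      (φ _) (ψ _) (c _) (Z φ v) (Z ψ v))

  Z-* : ∀ k φ v → Z (λ v → k * φ v) v ≡ k * Z φ v
  Z-* k φ v = trans (cong (κ v *_) (sym (*-distribˡ-sum k λ i → φ (increment i v))))
    (solve 3 (λ a k s → a :* (k :* s) := k :* (a :* s)) refl (κ v) k (sum λ i → φ (increment i v)))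

  X-* : ∀ i k φ v → X i (λ v → k * φ v) v ≡ k * X i φ v
  X-* i k φ v = trans (cong (λ z → k * φ (increment i v) - c (lookup v i) * z) (Z-* k φ v))
    (solve 4 (λ k x a z → k :* x :- a :* (k :* z) := k :* (x :- a :* z)) refl k (φ _) (c _) (Z φ v))

  increment-comm : ∀ i j (v : Vec ℕ d) → increment i (increment j v) ≡ increment j (increment i v)
  increment-comm i j v with i Fin.≟ j
  ... | yes refl = refl
  ... | no i≢j   = updateAt-commutes i j i≢j v

  -- Passing from v to v + εᵢ changes the i-th entry's coefficient from a to b. This adds (b - a) y
  -- to the sum of the increments, by `total-increment`, and the same amount to the subtracted sum,
  -- by `sum-lookup-increment`; the two corrections cancel.
  ZX≗XZ : ∀ i φ v → Z (X i φ) v ≡ X i (Z φ) v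
  ZX≗XZ i φ v = begin
    κ v * sum (λ j → φ (increment i (increment j v)) - c (lookup (increment j v) i) * t j)
      ≡⟨ cong (κ v *_) (trans
           (sum-cong-≗ λ j → cong₂ _+_ (cong φ (increment-comm i j v)) (sym (-1*≡- (s j))))
           (trans (∑-distrib-+ (λ j → φ (increment j v′)) (λ j → - 1ℚ * s j)) (cong (sum (λ j → φ (increment j v′)) +_)
             (trans (sym (*-distribˡ-sum (- 1ℚ) s)) (cong (- 1ℚ *_) (sum-lookup-increment c i v t)))))) ⟩
    κ v * (sum (λ j → φ (increment j v′)) + - 1ℚ * (a * sum t + (b - a) * y))
      ≡⟨ cong (λ s → κ v * (s + - 1ℚ * (a * sum t + (b - a) * y)))
           (trans (sum-increment φ v′) (cong (λ z → (1ℚ + z) * y) (total-increment c i v))) ⟩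
    κ v * ((1ℚ + (total c v + (b - a))) * y + - 1ℚ * (a * sum t + (b - a) * y))
      -- The unit is given to the solver as the atom o, so the two corrections appear as r and o r;
      -- the following steps evaluate o and cancel them.
      ≡⟨ solve 7 (λ k T a b y s o →
           k :* ((o :+ (T :+ (b :- a))) :* y :+ (:- o) :* (a :* s :+ (b :- a) :* y)) :=
           (k :* (o :+ T)) :* y :+ (k :* (b :- a) :* y :- o :* (k :* (b :- a) :* y)) :- o :* (a :* (k :* s)))
           refl (κ v) (total c v) a b y (sum t) 1ℚ ⟩
    (κ v * (1ℚ + total c v)) * y + (r - 1ℚ * r) - 1ℚ * (a * (κ v * sum t))
      ≡⟨ cong₂ (λ p q → p * y + (r - q) - 1ℚ * (a * (κ v * sum t))) (κ-inverse v) (ℚ.*-identityˡ r) ⟩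
    1ℚ * y + (r - r) - 1ℚ * (a * (κ v * sum t))
      ≡⟨ cong₂ (λ p q → p + (r - r) - q) (ℚ.*-identityˡ y) (ℚ.*-identityˡ _) ⟩
    y + (r - r) - a * (κ v * sum t)
      ≡⟨ solve 3 (λ y r q → y :+ (r :- r) :- q := y :- q) refl y r (a * (κ v * sum t)) ⟩
    y - a * (κ v * sum t) ∎
    where
    v′ = increment i v
    t  = λ j → Z φ (increment j v)
    s  = λ j → c (lookup (increment j v) i) * t j
    a  = c (lookup v i)
    b  = c (suc (lookup v i))
    y  = Z φ v′
    r  = κ v * (b - a) * y

  -- For distinct i and j, the increment at one leaves the entry at the other alone; after `ZX≗XZ`
  -- both sides expand to an expression symmetric in i and j.
  X-comm : ∀ i j φ v → X i (X j φ) v ≡ X j (X i φ) v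
  X-comm i j φ v with i Fin.≟ j
  ... | yes refl = refl
  ... | no i≢j   = begin
    X j φ (increment i v) - a * Z (X j φ) v
      ≡⟨ cong₂ (λ k z → φ (increment j (increment i v)) - k * Z φ (increment i v) - a * z)
           (cong c (lookup∘updateAt′ j i (i≢j ∘ sym) v)) (ZX≗XZ j φ v) ⟩
    φ (increment j (increment i v)) - b * Z φ (increment i v) - a * (Z φ (increment j v) - b * Z (Z φ) v)
      ≡⟨ cong (λ w → φ w - b * Z φ (increment i v) - a * (Z φ (increment j v) - b * Z (Z φ) v)) (increment-comm j i v) ⟩
    φ (increment i (increment j v)) - b * Z φ (increment i v) - a * (Z φ (increment j v) - b * Z (Z φ) v)
      ≡⟨ solve 6 (λ p a b x y z → p :- b :* x :- a :* (y :- b :* z) := p :- a :* y :- b :* (x :- a :* z)) refl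
           (φ (increment i (increment j v))) a b (Z φ (increment i v)) (Z φ (increment j v)) (Z (Z φ) v) ⟩
    φ (increment i (increment j v)) - a * Z φ (increment j v) - b * (Z φ (increment i v) - a * Z (Z φ) v)
      ≡⟨ cong₂ (λ k z → φ (increment i (increment j v)) - k * Z φ (increment j v) - b * z)
           (cong c (lookup∘updateAt′ i j i≢j v)) (ZX≗XZ i φ v) ⟨
    X i φ (increment j v) - b * Z (X i φ) v ∎
    where
    a = c (lookup v i)
    b = c (lookup v j)

  act : Poly (Fin d) → Φ → Φ
  act (con k) φ v = k * φ v
  act (var i) φ   = X i φ
  act (f ⊕ g) φ v = act f φ v + act g φ v
  act (f ⊗ g) φ   = act f (act g φ)

  act-cong : ∀ f → φ ≗ ψ → act f φ ≗ act f ψ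
  act-cong (con k) φ≗ψ v = cong (k *_) (φ≗ψ v)
  act-cong (var i) φ≗ψ   = X-cong i φ≗ψ
  act-cong (f ⊕ g) φ≗ψ v = cong₂ _+_ (act-cong f φ≗ψ v) (act-cong g φ≗ψ v)
  act-cong (f ⊗ g) φ≗ψ   = act-cong f (act-cong g φ≗ψ)

  act-+ : ∀ f φ ψ v → act f (λ v → φ v + ψ v) v ≡ act f φ v + act f ψ v
  act-+ (con k) φ ψ v = ℚ.*-distribˡ-+ k _ _
  act-+ (var i) φ ψ v = X-+ i φ ψ v
  act-+ (f ⊕ g) φ ψ v = trans (cong₂ _+_ (act-+ f φ ψ v) (act-+ g φ ψ v))
    (solve 4 (λ a b c d → (a :+ b) :+ (c :+ d) := (a :+ c) :+ (b :+ d)) refl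
      (act f φ v) (act f ψ v) (act g φ v) (act g ψ v))
  act-+ (f ⊗ g) φ ψ v = trans (act-cong f (act-+ g φ ψ) v) (act-+ f _ _ v)

  act-* : ∀ f k φ v → act f (λ v → k * φ v) v ≡ k * act f φ v
  act-* (con l) k φ v = solve 3 (λ l k x → l :* (k :* x) := k :* (l :* x)) refl l k (φ v)
  act-* (var i) k φ v = X-* i k φ v
  act-* (f ⊕ g) k φ v = trans (cong₂ _+_ (act-* f k φ v) (act-* g k φ v)) (sym (ℚ.*-distribˡ-+ k (act f φ v) _))
  act-* (f ⊗ g) k φ v = trans (act-cong f (act-* g k φ) v) (act-* f k _ v)

  -- Recursion on f, and on g once f is a variable, reduces this by linearity to the generators
  -- `X i` and `X j`.
  act-comm : ∀ f g φ → act f (act g φ) ≗ act g (act f φ)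
  act-comm (con k) g       φ v = sym (act-* g k φ v)
  act-comm (f ⊕ f′) g      φ v = trans (cong₂ _+_ (act-comm f g φ v) (act-comm f′ g φ v)) (sym (act-+ g _ _ v))
  act-comm (f ⊗ f′) g      φ v = trans (act-cong f (act-comm f′ g φ) v) (act-comm f g (act f′ φ) v)
  act-comm (var i) (con k) φ v = X-* i k φ v
  act-comm (var i) (var j) φ v = X-comm i j φ v
  act-comm (var i) (g ⊕ h) φ v = trans (X-+ i (act g φ) (act h φ) v) (cong₂ _+_ (act-comm (var i) g φ v) (act-comm (var i) h φ v))
  act-comm (var i) (g ⊗ h) φ v = trans (act-comm (var i) g (act h φ) v) (act-cong g (act-comm (var i) h φ) v)

  -- This makes the action one of polynomials and not merely of expressions. The laws with content
  -- are `⊗-comm`, which is `act-comm`, and `⊗-distribˡ`, which is additivity of the operators.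
  act-≋ : ∀ {f g} → f ≋ g → ∀ φ → act f φ ≗ act g φ
  act-≋ ≋-refl                        φ v = refl
  act-≋ (≋-sym p)                     φ v = sym (act-≋ p φ v)
  act-≋ (≋-trans p q)                 φ v = trans (act-≋ p φ v) (act-≋ q φ v)
  act-≋ (⊕-cong p q)                  φ v = cong₂ _+_ (act-≋ p φ v) (act-≋ q φ v)
  act-≋ (⊗-cong {f} {f′} {g} {g′} p q) φ v = trans (act-≋ p (act g φ) v) (act-cong f′ (act-≋ q φ) v)
  act-≋ (⊕-assoc f g h)               φ v = ℚ.+-assoc (act f φ v) _ _
  act-≋ (⊕-comm f g)                  φ v = ℚ.+-comm (act f φ v) _
  act-≋ (⊕-identityˡ f)               φ v = trans (cong (_+ act f φ v) (ℚ.*-zeroˡ (φ v))) (ℚ.+-identityˡ _)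
  act-≋ (⊗-assoc f g h)               φ v = refl
  act-≋ (⊗-comm f g)                  φ v = act-comm f g φ v
  act-≋ (⊗-identityˡ f)               φ v = ℚ.*-identityˡ _
  act-≋ (⊗-zeroˡ f)                   φ v = trans (ℚ.*-zeroˡ (act f φ v)) (sym (ℚ.*-zeroˡ (φ v)))
  act-≋ (⊗-distribˡ f g h)            φ v = act-+ f _ _ v
  act-≋ (con-⊕ a b)                   φ v = ℚ.*-distribʳ-+ (φ v) a b
  act-≋ (con-⊗ a b)                   φ v = ℚ.*-assoc a b (φ v)

-- Polynomials

module Substitution {V W : Set} (σ : V → Poly W) where
  private
    module V = Bialternant (polyRing V)
    module W = Bialternant (polyRing W)
    open import Algebra.Properties.Semiring.Exp (CommutativeRing.semiring (polyRing V)) using (_^_)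
    open import Algebra.Properties.Semiring.Exp (CommutativeRing.semiring (polyRing W)) using () renaming (_^_ to _^′_)

  substitute-≋ : ∀ {f g} → f ≋ g → substitute σ f ≋ substitute σ g
  substitute-≋ ≋-refl             = ≋-refl
  substitute-≋ (≋-sym p)          = ≋-sym (substitute-≋ p)
  substitute-≋ (≋-trans p q)      = ≋-trans (substitute-≋ p) (substitute-≋ q)
  substitute-≋ (⊕-cong p q)       = ⊕-cong (substitute-≋ p) (substitute-≋ q)
  substitute-≋ (⊗-cong p q)       = ⊗-cong (substitute-≋ p) (substitute-≋ q)
  substitute-≋ (⊕-assoc f g h)    = ⊕-assoc _ _ _
  substitute-≋ (⊕-comm f g)       = ⊕-comm _ _
  substitute-≋ (⊕-identityˡ f)    = ⊕-identityˡ _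
  substitute-≋ (⊗-assoc f g h)    = ⊗-assoc _ _ _
  substitute-≋ (⊗-comm f g)       = ⊗-comm _ _
  substitute-≋ (⊗-identityˡ f)    = ⊗-identityˡ _
  substitute-≋ (⊗-zeroˡ f)        = ⊗-zeroˡ _
  substitute-≋ (⊗-distribˡ f g h) = ⊗-distribˡ _ _ _
  substitute-≋ (con-⊕ a b)        = con-⊕ a b
  substitute-≋ (con-⊗ a b)        = con-⊗ a b

  substitute-sum : ∀ {n} (t : Fin n → Poly V) → substitute σ (V.sum t) ≡ W.sum (substitute σ ∘ t)
  substitute-sum {zero}  t = refl
  substitute-sum {suc n} t = cong (substitute σ (t zero) ⊕_) (substitute-sum (t ∘ suc))

  substitute-product : ∀ {n} (t : Fin n → Poly V) →
                       substitute σ (V.product t) ≡ W.product (substitute σ ∘ t)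
  substitute-product {zero}  t = refl
  substitute-product {suc n} t = cong (substitute σ (t zero) ⊗_) (substitute-product (t ∘ suc))

  substitute-vandermonde : ∀ {n} (x : Fin n → Poly V) →
                           substitute σ (V.vandermonde x) ≡ W.vandermonde (substitute σ ∘ x)
  substitute-vandermonde {zero}  x = refl
  substitute-vandermonde {suc n} x =
    cong₂ _⊗_ (substitute-product λ j → x zero ⊕ ⊖ x (suc j)) (substitute-vandermonde (x ∘ suc))

  substitute-factorialPower : ∀ t y n →
    substitute σ (V.factorialPower t y n) ≡ W.factorialPower (substitute σ ∘ t) (substitute σ y) n
  substitute-factorialPower t y n = substitute-product {n} λ l → y ⊕ ⊖ t (toℕ l)

  substitute-sign : ∀ n → substitute σ ((⊖ con 1ℚ) ^ n) ≡ (⊖ con 1ℚ) ^′ n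
  substitute-sign zero    = refl
  substitute-sign (suc n) = cong (⊖ con 1ℚ ⊗_) (substitute-sign n)

  substitute-det : ∀ {n} (M : Fin n → Fin n → Poly V) →
                   substitute σ (V.det M) ≡ W.det (λ i j → substitute σ (M i j))
  substitute-det {zero}  M = refl
  substitute-det {suc n} M = trans (substitute-sum λ i → (⊖ con 1ℚ) ^ toℕ i ⊗ (M i zero ⊗ V.det (minor i)))
    (sum-cong-≗′ λ i → cong₂ (λ s m → s ⊗ (substitute σ (M i zero) ⊗ m))
      (substitute-sign (toℕ i)) (substitute-det (minor i)))
    where
    open import Algebra.Properties.Monoid.Sum (CommutativeRing.+-monoid (polyRing W)) using () renaming (sum-cong-≗ to sum-cong-≗′)
    minor = λ i r s → M (punchIn i r) (suc s)

open Substitution public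

-- Formal linear combinations and spans

module Combination {V I : Set} (b : I → Poly V) where
  open CommutativeRing (polyRing V) using (setoid; +-congˡ; *-congˡ)
  open import Relation.Binary.Reasoning.Setoid setoid

  -- Indices may repeat in the list, so that adding combinations is concatenation; repetitions are
  -- collected only for `combination-0`.
  combination : List (ℚ × I) → Poly V
  combination []            = con 0ℚ
  combination ((k , i) ∷ l) = con k ⊗ b i ⊕ combination l

  combination-++ : ∀ l l′ → combination (l ++ l′) ≋ combination l ⊕ combination l′
  combination-++ []            l′ = ≋-sym (⊕-identityˡ _)
  combination-++ ((k , i) ∷ l) l′ = ≋-trans (+-congˡ (combination-++ l l′)) (≋-sym (⊕-assoc _ _ _))

  combination-scale : ∀ k l → combination (List.map (λ (m , i) → k * m , i) l) ≋ con k ⊗ combination l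
  combination-scale k []            = ≋-sym (≋-trans (⊗-comm _ _) (⊗-zeroˡ _))
  combination-scale k ((m , i) ∷ l) = ≋-trans
    (⊕-cong (≋-trans (⊗-cong (con-⊗ k m) ≋-refl) (⊗-assoc _ _ _)) (combination-scale k l))
    (≋-sym (⊗-distribˡ _ _ _))

  Spanned : Poly V → Set
  Spanned f = ∃ λ l → f ≋ combination l

  spanned-≋ : ∀ {f g} → f ≋ g → Spanned f → Spanned g
  spanned-≋ f≋g (l , p) = l , ≋-trans (≋-sym f≋g) p

  spanned-basis : ∀ i → Spanned (b i)
  spanned-basis i = (1ℚ , i) ∷ [] ,
    ≋-sym (≋-trans (⊕-comm _ _) (≋-trans (⊕-identityˡ _) (⊗-identityˡ _)))

  spanned-⊕ : ∀ {f g} → Spanned f → Spanned g → Spanned (f ⊕ g)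
  spanned-⊕ (l , p) (l′ , p′) = l ++ l′ , ≋-trans (⊕-cong p p′) (≋-sym (combination-++ l l′))

  spanned-scale : ∀ k {f} → Spanned f → Spanned (con k ⊗ f)
  spanned-scale k (l , p) = _ , ≋-trans (*-congˡ p) (≋-sym (combination-scale k l))

  open Bialternant (polyRing V) using () renaming (sum to ∑)

  spanned-sum : ∀ {n} {t : Fin n → Poly V} → (∀ i → Spanned (t i)) → Spanned (∑ t)
  spanned-sum {zero}  s = [] , ≋-refl
  spanned-sum {suc n} s = spanned-⊕ (s zero) (spanned-sum (s ∘ suc))

  spanned-closed : ∀ (h : Poly V) → (∀ i → Spanned (h ⊗ b i)) → ∀ {f} → Spanned f → Spanned (h ⊗ f)
  spanned-closed h s (l , p) = spanned-≋ (*-congˡ (≋-sym p)) (go l)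
    where
    go : ∀ l → Spanned (h ⊗ combination l)
    go []            = [] , ≋-trans (⊗-comm _ _) (⊗-zeroˡ _)
    go ((k , i) ∷ l) = spanned-≋ (begin
      con k ⊗ (h ⊗ b i) ⊕ h ⊗ combination l  ≈⟨ ⊕-cong (≋-trans (≋-sym (⊗-assoc _ _ _))
                                                   (≋-trans (⊗-cong (⊗-comm _ _) ≋-refl) (⊗-assoc _ _ _))) ≋-refl ⟩
      h ⊗ (con k ⊗ b i) ⊕ h ⊗ combination l  ≈⟨ ⊗-distribˡ _ _ _ ⟨
      h ⊗ (con k ⊗ b i ⊕ combination l)      ∎)
      (spanned-⊕ (spanned-scale k (s i)) (go l))

open Combination public

-- Pairing functionals with formal combinations

evaluate : ∀ {I : Set} → (I → ℚ) → List (ℚ × I) → ℚ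
evaluate φ []            = 0ℚ
evaluate φ ((k , i) ∷ l) = k * φ i + evaluate φ l

vec-induction : ∀ {n} (Q : Vec ℕ n → Set) → Q (Vec.replicate n 0) →
                (∀ i v → Q v → Q (increment i v)) → ∀ v → Q v
vec-induction Q q₀ q []      = q₀
vec-induction Q q₀ q (x ∷ v) = vec-induction (Q ∘ (x ∷_)) (start x) (λ i v → q (suc i) (x ∷ v)) v
  where
  start : ∀ x → Q (x ∷ Vec.replicate _ 0)
  start zero    = q₀
  start (suc x) = q zero (x ∷ _) (start x)

module _ {d : ℕ} where

  infix 4 _≟ᵥ_
  _≟ᵥ_ : (v w : Vec ℕ d) → Dec (v ≡ w)
  _≟ᵥ_ = ≡-dec ℕ._≟_

  δ : Vec ℕ d → Vec ℕ d → ℚ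
  δ m v with v ≟ᵥ m
  ... | yes _ = 1ℚ
  ... | no  _ = 0ℚ

  δ-≡ : ∀ {m v} → v ≡ m → δ m v ≡ 1ℚ
  δ-≡ {m} {v} v≡m with v ≟ᵥ m
  ... | yes _  = refl
  ... | no v≢m = ⊥-elim (v≢m v≡m)

  δ-≢ : ∀ {m v} → v ≢ m → δ m v ≡ 0ℚ
  δ-≢ {m} {v} v≢m with v ≟ᵥ m
  ... | yes v≡m = ⊥-elim (v≢m v≡m)
  ... | no _    = refl

module _ {V : Set} {d : ℕ} (b : Vec ℕ d → Poly V) where
  open CommutativeRing (polyRing V) using (setoid)
  open import Relation.Binary.Reasoning.Setoid setoid

  private
    term-0 : ∀ {k} → k ≡ 0ℚ → ∀ {f : Poly V} → con k ⊗ f ≋ con 0ℚ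
    term-0 refl = ⊗-zeroˡ _

    collect : (Vec ℕ d → ℚ) → List (Vec ℕ d) → Poly V
    collect a S = combination b (List.map (λ s → a s , s) S)

    collect-0 : ∀ a S → All (λ s → a s ≡ 0ℚ) S → collect a S ≋ con 0ℚ
    collect-0 a []      []       = ≋-refl
    collect-0 a (s ∷ S) (p ∷ ps) = ≋-trans (⊕-cong (term-0 p {b s}) (collect-0 a S ps)) (⊕-identityˡ _)

    collect-+ : ∀ a a′ S → collect (λ s → a s + a′ s) S ≋ collect a S ⊕ collect a′ S
    collect-+ a a′ []      = ≋-sym (⊕-identityˡ _)
    collect-+ a a′ (s ∷ S) = begin
      con (a s + a′ s) ⊗ b s ⊕ collect (λ s → a s + a′ s) S
        ≈⟨ ⊕-cong (≋-trans (⊗-cong (con-⊕ _ _) ≋-refl) (⊗-distribʳ _ _ _)) (collect-+ a a′ S) ⟩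
      (con (a s) ⊗ b s ⊕ con (a′ s) ⊗ b s) ⊕ (collect a S ⊕ collect a′ S)
        ≈⟨ interchange _ _ _ _ ⟩
      (con (a s) ⊗ b s ⊕ collect a S) ⊕ (con (a′ s) ⊗ b s ⊕ collect a′ S) ∎
      where
      open import Algebra.Properties.CommutativeSemigroup
        (CommutativeRing.+-commutativeSemigroup (polyRing V)) using (interchange)

    collect-δ : ∀ k {v S} → v ∈ S → Unique S → collect (λ s → k * δ s v) S ≋ con k ⊗ b v
    collect-δ k {v} {s ∷ S} (here refl) (s∉S ∷ _) = begin
      con (k * δ v v) ⊗ b v ⊕ collect (λ s → k * δ s v) S
        ≈⟨ ⊕-cong (CommutativeRing.reflexive (polyRing V) (cong (λ q → con q ⊗ b v)
             (trans (cong (k *_) (δ-≡ {v = v} refl)) (ℚ.*-identityʳ k))))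
             (collect-0 _ S (All.map (λ v≢s → trans (cong (k *_) (δ-≢ v≢s)) (ℚ.*-zeroʳ k)) s∉S)) ⟩
      con k ⊗ b v ⊕ con 0ℚ ≈⟨ ≋-trans (⊕-comm _ _) (⊕-identityˡ _) ⟩
      con k ⊗ b v ∎
    collect-δ k {v} {s ∷ S} (there v∈S) (s∉S ∷ u) =
      ≋-trans (⊕-cong (term-0 (trans (cong (k *_) (δ-≢ (All.lookup s∉S v∈S ∘ sym))) (ℚ.*-zeroʳ k)))
                      (collect-δ k v∈S u))
              (⊕-identityˡ _)

    -- Each term of l is spread over S as a multiple of a delta function; since S has no
    -- repetitions, it is counted exactly once.
    combination-collect : ∀ S → Unique S → ∀ l → (∀ {v} → v ∈ List.map proj₂ l → v ∈ S) →
                          combination b l ≋ collect (λ s → evaluate (δ s) l) S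
    combination-collect S u []            sub = ≋-sym (collect-0 _ S (All.universal (λ _ → refl) S))
    combination-collect S u ((k , v) ∷ l) sub = begin
      con k ⊗ b v ⊕ combination b l
        ≈⟨ ⊕-cong (collect-δ k (sub (here refl)) u)
             (≋-sym (combination-collect S u l (sub ∘ there))) ⟨
      collect (λ s → k * δ s v) S ⊕ collect (λ s → evaluate (δ s) l) S
        ≈⟨ collect-+ (λ s → k * δ s v) (λ s → evaluate (δ s) l) S ⟨
      collect (λ s → evaluate (δ s) ((k , v) ∷ l)) S  ∎

  -- Once the indices of l are deduplicated, the collected coefficient at m is the pairing with
  -- `δ m`.
  combination-0 : ∀ l → (∀ m → evaluate (δ m) l ≡ 0ℚ) → combination b l ≋ con 0ℚ
  combination-0 l p = ≋-trans
    (combination-collect S (deduplicate-! _≟ᵥ_ (List.map proj₂ l)) l (∈-deduplicate⁺ _≟ᵥ_))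
    (collect-0 _ S (All.universal p S))
    where S = List.deduplicate _≟ᵥ_ (List.map proj₂ l)

-- Twisted monomials

module ProductOfRing {V : Set} where
  open CommutativeRing (polyRing V)
  open Bialternant (polyRing V) using (product; factorialPower)
  open import Algebra.Properties.CommutativeMonoid.Sum (CommutativeRing.*-commutativeMonoid (polyRing V))
    using () renaming (sum-remove to product-remove; sum-cong-≋ to product-cong; sum-init-last to product-init-last)
  open import Relation.Binary.Reasoning.Setoid setoid

  product-scale : ∀ {n} (i : Fin n) {a} {f g : Fin n → Poly V} → g i ≋ a ⊗ f i →
                  (∀ j → j ≢ i → g j ≋ f j) → product g ≋ a ⊗ product f
  product-scale {suc n} i {a} {f} {g} gᵢ g≋f = begin
    product g
      ≈⟨ product-remove {i = i} g ⟩
    g i ⊗ product (g ∘ punchIn i)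
      ≈⟨ ⊗-cong gᵢ (product-cong λ j → g≋f (punchIn i j) (Fin.punchInᵢ≢i i j)) ⟩
    (a ⊗ f i) ⊗ product (f ∘ punchIn i)
      ≈⟨ ⊗-assoc _ _ _ ⟩
    a ⊗ (f i ⊗ product (f ∘ punchIn i))
      ≈⟨ *-congˡ (product-remove {i = i} f) ⟨
    a ⊗ product f ∎

  -- The definition unfolds at the first factor, whereas raising an exponent appends a last one.
  factorialPower-suc : ∀ t y n → factorialPower t y (suc n) ≋ (y ⊕ ⊖ t n) ⊗ factorialPower t y n
  factorialPower-suc t y n = begin
    factorialPower t y (suc n)
      ≈⟨ product-init-last (λ (l : Fin (suc n)) → y ⊕ ⊖ t (toℕ l)) ⟩
    product (λ (l : Fin n) → y ⊕ ⊖ t (toℕ (inject₁ l))) ⊗ (y ⊕ ⊖ t (toℕ (fromℕ n)))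
      ≈⟨ ⊗-cong (product-cong {n} λ l → reflexive (cong (λ p → y ⊕ ⊖ t p) (Fin.toℕ-inject₁ l)))
                (reflexive (cong (λ p → y ⊕ ⊖ t p) (Fin.toℕ-fromℕ n))) ⟩
    factorialPower t y n ⊗ (y ⊕ ⊖ t n)
      ≈⟨ ⊗-comm _ _ ⟩
    (y ⊕ ⊖ t n) ⊗ factorialPower t y n ∎

open ProductOfRing public

module Coordinates {d : ℕ} (c : ℕ → ℚ) (κ : Vec ℕ d → ℚ)
  (κ-inverse : ∀ v → κ v * (1ℚ + total c v) ≡ 1ℚ) where

  open Operators c κ κ-inverse public
  open Bialternant (polyRing (Fin d)) using (product; factorialPower) renaming (sum to ∑)
  open CommutativeRing (polyRing (Fin d)) using (setoid; *-congˡ; *-congʳ; +-congˡ; semiring)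

  private variable φ : Vec ℕ d → ℚ

  e₁ : Poly (Fin d)
  e₁ = ∑ var

  twist : ℕ → Poly (Fin d)
  twist l = con (- c l) ⊗ e₁

  power : ℕ → Fin d → Poly (Fin d)
  power p i = factorialPower twist (var i) p

  -- This is Nᵥ: `twist` carries the minus sign, so the factors are xᵢ + cₗ e₁.
  monomial : Vec ℕ d → Poly (Fin d)
  monomial v = product λ i → power (lookup v i) i

  act-∑ : ∀ {n} (t : Fin n → Poly (Fin d)) φ v → act (∑ t) φ v ≡ sum (λ i → act (t i) φ v)
  act-∑ {zero}  t φ v = ℚ.*-zeroˡ (φ v)
  act-∑ {suc n} t φ v = cong (act (t zero) φ v +_) (act-∑ (t ∘ suc) φ v)

  -- Consistency of the two formulas: in Σᵢ `X i` the increments give (1 + Σᵢ c(vᵢ)) Z, from which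
  -- Σᵢ c(vᵢ) Z is subtracted.
  act-e₁ : ∀ φ v → act e₁ φ v ≡ Z φ v
  act-e₁ φ v = begin
    act e₁ φ v
      ≡⟨ act-∑ var φ v ⟩
    sum (λ i → φ (increment i v) + - (c (lookup v i) * Z φ v))
      ≡⟨ sum-cong-≗ (λ i → cong (φ (increment i v) +_) (move (c (lookup v i)) (Z φ v))) ⟩
    sum (λ i → φ (increment i v) + - Z φ v * c (lookup v i))
      ≡⟨ ∑-distrib-+ (λ i → φ (increment i v)) (λ i → - Z φ v * c (lookup v i)) ⟩
    sum (λ i → φ (increment i v)) + sum (λ i → - Z φ v * c (lookup v i))
      ≡⟨ cong₂ _+_ (sum-increment φ v) (sym (*-distribˡ-sum (- Z φ v) (c ∘ lookup v))) ⟩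
    (1ℚ + total c v) * Z φ v + - Z φ v * total c v
      ≡⟨ solve 3 (λ o t z → (o :+ t) :* z :+ (:- z) :* t := o :* z) refl 1ℚ (total c v) (Z φ v) ⟩
    1ℚ * Z φ v
      ≡⟨ ℚ.*-identityˡ _ ⟩
    Z φ v ∎
    where
    open ≡-Reasoning
    move : ∀ p q → - (p * q) ≡ - q * p
    move = solve 2 (λ p q → :- (p :* q) := (:- q) :* p) refl

  -- The e₁ term of the factor cancels the correction in `X i` and leaves the pure shift.
  act-factor : ∀ i φ v → act (var i ⊕ ⊖ twist (lookup v i)) φ v ≡ φ (increment i v)
  act-factor i φ v = begin
    X i φ v + - 1ℚ * (- a * act e₁ φ v)    ≡⟨ cong (λ z → X i φ v + - 1ℚ * (- a * z)) (act-e₁ φ v) ⟩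
    X i φ v + - 1ℚ * (- a * Z φ v)         ≡⟨ solve 4 (λ x a z o → (x :- a :* z) :+ (:- o) :* ((:- a) :* z) :=
                                                x :+ (o :* (a :* z) :- a :* z)) refl
                                                (φ (increment i v)) a (Z φ v) 1ℚ ⟩
    φ (increment i v) + (1ℚ * y - y)       ≡⟨ cong (λ z → φ (increment i v) + (z - y)) (ℚ.*-identityˡ y) ⟩
    φ (increment i v) + (y - y)            ≡⟨ cong (φ (increment i v) +_) (ℚ.+-inverseʳ y) ⟩
    φ (increment i v) + 0ℚ                 ≡⟨ ℚ.+-identityʳ _ ⟩
    φ (increment i v)                      ∎
    where
    open ≡-Reasoning
    a = c (lookup v i)
    y = a * Z φ v

  private
    -- Each factor shifts the i-th entry by one, and the next twist then matches the new entry, so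
    -- `act-factor` applies again. The offset q is the entry reached so far.
    act-power-from : ∀ i p q s → (∀ l → s l ≡ twist (q ℕ.+ l)) → ∀ φ v → lookup v i ≡ q →
                     act (factorialPower s (var i) p) φ v ≡ φ (updateAt v i (p ℕ.+_))
    act-power-from i zero    q s s≗ φ v vᵢ = trans (ℚ.*-identityˡ (φ v)) (cong φ (sym (updateAt-id-local i v refl)))
    act-power-from i (suc p) q s s≗ φ v vᵢ = begin
      act (var i ⊕ ⊖ s 0) ψ v
        ≡⟨ cong (λ t → act (var i ⊕ ⊖ t) ψ v) (trans (s≗ 0) (cong twist (trans (ℕ.+-identityʳ q) (sym vᵢ)))) ⟩
      act (var i ⊕ ⊖ twist (lookup v i)) ψ v
        ≡⟨ act-factor i ψ v ⟩
      ψ (increment i v)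
        ≡⟨ act-power-from i p (suc q) (s ∘ suc) (λ l → trans (s≗ (suc l)) (cong twist (ℕ.+-suc q l))) φ
             (increment i v) (trans (lookup∘updateAt i v) (cong suc vᵢ)) ⟩
      φ (updateAt (increment i v) i (p ℕ.+_))
        ≡⟨ cong φ (updateAt-updateAt-local i v (ℕ.+-suc p (lookup v i))) ⟩
      φ (updateAt v i (suc p ℕ.+_)) ∎
      where
      open ≡-Reasoning
      ψ = act (factorialPower (s ∘ suc) (var i) p) φ

  act-power : ∀ p i φ v → lookup v i ≡ 0 → act (power p i) φ v ≡ φ (v [ i ]≔ p)
  act-power p i φ v vᵢ = trans (act-power-from i p 0 twist (λ _ → refl) φ v vᵢ)
    (cong φ (updateAt-cong-local i v (trans (cong (p ℕ.+_) vᵢ) (ℕ.+-identityʳ p))))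

  monomial-increment : ∀ i v → monomial (increment i v) ≋ (var i ⊕ ⊖ twist (lookup v i)) ⊗ monomial v
  monomial-increment i v = product-scale i
    (≋-trans (reflexive (cong (λ p → power p i) (lookup∘updateAt i v))) (factorialPower-suc twist (var i) (lookup v i)))
    (λ j j≢i → reflexive (cong (λ p → power p j) (lookup∘updateAt′ j i j≢i v)))
    where open CommutativeRing (polyRing (Fin d)) using (reflexive)

  origin : Vec ℕ d
  origin = Vec.replicate d 0

  monomial-origin : monomial origin ≋ con 1ℚ
  monomial-origin = ≋-trans (product-cong {d} λ i → reflexive (cong (λ p → power p i) (lookup-replicate i 0)))
                            (product-1 d)
    where
    open CommutativeRing (polyRing (Fin d)) using (reflexive)
    open import Algebra.Properties.CommutativeMonoid.Sum (CommutativeRing.*-commutativeMonoid (polyRing (Fin d)))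
      using () renaming (sum-cong-≋ to product-cong; sum-replicate-zero to product-1)

  -- Since N at the origin is 1, evaluating there pairs φ with the expansion of f in the Nᵥ; with φ
  -- = `δ m` it extracts the coefficient of `monomial m`.
  coordinate : (Vec ℕ d → ℚ) → Poly (Fin d) → ℚ
  coordinate φ f = act f φ origin

  coordinate-≋ : ∀ φ {f g} → f ≋ g → coordinate φ f ≡ coordinate φ g
  coordinate-≋ φ f≋g = act-≋ f≋g φ origin

  coordinate-monomial : ∀ v φ → coordinate φ (monomial v) ≡ φ v
  coordinate-monomial = vec-induction (λ v → ∀ φ → coordinate φ (monomial v) ≡ φ v)
    (λ φ → trans (coordinate-≋ φ monomial-origin) (ℚ.*-identityˡ (φ origin)))
    λ i v ih φ → trans
      -- Moved to the right, the new factor acts on φ first; the induction hypothesis evaluates the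
      -- result at v, where the factor is a shift.
      (coordinate-≋ φ (≋-trans (monomial-increment i v) (⊗-comm _ _)))
      (trans (ih (act (var i ⊕ ⊖ twist (lookup v i)) φ)) (act-factor i φ v))

  coordinate-combination : ∀ {I : Set} (b : I → Poly (Fin d)) {φ ψ} →
                           (∀ i → coordinate φ (b i) ≡ ψ i) →
                           ∀ l → coordinate φ (combination b l) ≡ evaluate ψ l
  coordinate-combination b {φ} p []            = ℚ.*-zeroˡ (φ origin)
  coordinate-combination b     p ((k , i) ∷ l) =
    cong₂ _+_ (cong (k *_) (p i)) (coordinate-combination b p l)

  coordinate-monomials : ∀ φ l → coordinate φ (combination monomial l) ≡ evaluate φ l
  coordinate-monomials φ = coordinate-combination monomial λ v → coordinate-monomial v φ

  private
    module R = CommutativeRing (polyRing (Fin d))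
    open import Algebra.Properties.Semiring.Sum semiring
      using () renaming (*-distribʳ-sum to ∑-distribʳ; ∑-distrib-+ to ∑-⊕; sum-cong-≋ to ∑-cong)
    open import Relation.Binary.Reasoning.Setoid setoid

    factor : ∀ i k → var i ⊕ ⊖ (con (- k) ⊗ e₁) ≋ var i ⊕ con k ⊗ e₁
    factor i k = +-congˡ (≋-trans (≋-sym (⊗-assoc _ _ _))
      (*-congʳ (≋-trans (≋-sym (con-⊗ _ _)) (R.reflexive (cong con
        (trans (solve 2 (λ o k → (:- o) :* (:- k) := o :* k) refl 1ℚ k) (ℚ.*-identityˡ k)))))))

    con-∑ : ∀ {n} (t : Fin n → ℚ) → ∑ (con ∘ t) ≋ con (sum t)
    con-∑ {zero}  t = ≋-refl
    con-∑ {suc n} t = ≋-trans (+-congˡ (con-∑ (t ∘ suc))) (≋-sym (con-⊕ _ _))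

    ∑-increment : ∀ v → ∑ (λ i → monomial (increment i v)) ≋ con (1ℚ + total c v) ⊗ (e₁ ⊗ monomial v)
    ∑-increment v = begin
      ∑ (λ i → monomial (increment i v))
        ≈⟨ ∑-cong (λ i → ≋-trans (monomial-increment i v) (*-congʳ (factor i (a i)))) ⟩
      ∑ (λ i → (var i ⊕ con (a i) ⊗ e₁) ⊗ monomial v)
        ≈⟨ ∑-distribʳ (monomial v) (λ i → var i ⊕ con (a i) ⊗ e₁) ⟨
      ∑ (λ i → var i ⊕ con (a i) ⊗ e₁) ⊗ monomial v
        ≈⟨ *-congʳ (∑-⊕ var (λ i → con (a i) ⊗ e₁)) ⟩
      (e₁ ⊕ ∑ (λ i → con (a i) ⊗ e₁)) ⊗ monomial v
        ≈⟨ *-congʳ (⊕-cong (⊗-identityˡ e₁) (≋-trans (*-congʳ (≋-sym (con-∑ a))) (∑-distribʳ e₁ (con ∘ a)))) ⟨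
      (con 1ℚ ⊗ e₁ ⊕ con (total c v) ⊗ e₁) ⊗ monomial v
        ≈⟨ *-congʳ (≋-trans (*-congʳ (con-⊕ _ _)) (⊗-distribʳ _ _ _)) ⟨
      (con (1ℚ + total c v) ⊗ e₁) ⊗ monomial v
        ≈⟨ ⊗-assoc _ _ _ ⟩
      con (1ℚ + total c v) ⊗ (e₁ ⊗ monomial v) ∎
      where a = λ i → c (lookup v i)

  spanned-e₁⊗monomial : ∀ v → Spanned monomial (e₁ ⊗ monomial v)
  spanned-e₁⊗monomial v = spanned-≋ monomial (begin
    con (κ v) ⊗ ∑ (λ i → monomial (increment i v))
      ≈⟨ *-congˡ (∑-increment v) ⟩
    con (κ v) ⊗ (con (1ℚ + total c v) ⊗ (e₁ ⊗ monomial v))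
      ≈⟨ ⊗-assoc _ _ _ ⟨
    (con (κ v) ⊗ con (1ℚ + total c v)) ⊗ (e₁ ⊗ monomial v)
      ≈⟨ *-congʳ (≋-trans (≋-sym (con-⊗ _ _)) (R.reflexive (cong con (κ-inverse v)))) ⟩
    con 1ℚ ⊗ (e₁ ⊗ monomial v)
      ≈⟨ ⊗-identityˡ _ ⟩
    e₁ ⊗ monomial v ∎)
    (spanned-scale monomial (κ v) (spanned-sum monomial λ i → spanned-basis monomial (increment i v)))

  spanned-var⊗monomial : ∀ i v → Spanned monomial (var i ⊗ monomial v)
  spanned-var⊗monomial i v = spanned-≋ monomial (begin
    monomial (increment i v) ⊕ con (- k) ⊗ (e₁ ⊗ monomial v)
      ≈⟨ ⊕-cong (≋-trans (monomial-increment i v) (*-congʳ (factor i k))) (≋-sym (⊗-assoc _ _ _)) ⟩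
    (var i ⊕ con k ⊗ e₁) ⊗ monomial v ⊕ (con (- k) ⊗ e₁) ⊗ monomial v
      ≈⟨ ⊗-distribʳ _ _ _ ⟨
    ((var i ⊕ con k ⊗ e₁) ⊕ con (- k) ⊗ e₁) ⊗ monomial v
      ≈⟨ *-congʳ (≋-trans (⊕-assoc _ _ _) (+-congˡ (begin
           con k ⊗ e₁ ⊕ con (- k) ⊗ e₁  ≈⟨ ⊗-distribʳ _ _ _ ⟨
           (con k ⊕ con (- k)) ⊗ e₁     ≈⟨ *-congʳ (≋-trans (≋-sym (con-⊕ _ _)) (R.reflexive (cong con (ℚ.+-inverseʳ k)))) ⟩
           con 0ℚ ⊗ e₁                  ≈⟨ ⊗-zeroˡ _ ⟩
           con 0ℚ                       ∎))) ⟩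
    (var i ⊕ con 0ℚ) ⊗ monomial v
      ≈⟨ *-congʳ (≋-trans (⊕-comm _ _) (⊕-identityˡ _)) ⟩
    var i ⊗ monomial v ∎)
    (spanned-⊕ monomial (spanned-basis monomial (increment i v))
      (spanned-scale monomial (- k) (spanned-e₁⊗monomial v)))
    where k = c (lookup v i)

  spanned-⊗ : ∀ f {g} → Spanned monomial g → Spanned monomial (f ⊗ g)
  spanned-⊗ (con k) s = spanned-scale monomial k s
  spanned-⊗ (var i) s = spanned-closed monomial (var i) (spanned-var⊗monomial i) s
  spanned-⊗ (f ⊕ h) s = spanned-≋ monomial (≋-sym (⊗-distribʳ _ _ _))
                          (spanned-⊕ monomial (spanned-⊗ f s) (spanned-⊗ h s))
  spanned-⊗ (f ⊗ h) s = spanned-≋ monomial (≋-sym (⊗-assoc _ _ _)) (spanned-⊗ f (spanned-⊗ h s))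

  -- f is f times N at the origin, and multiplication by f preserves the span.
  monomials-span : ∀ f → Spanned monomial f
  monomials-span f = spanned-≋ monomial (≋-trans (⊗-comm _ _) (⊗-identityˡ f))
    (spanned-⊗ f (spanned-≋ monomial monomial-origin (spanned-basis monomial origin)))

  -- The coordinates are the collected coefficients of any expansion of f in the Nᵥ.
  coordinates-0 : ∀ f → (∀ m → coordinate (δ m) f ≡ 0ℚ) → f ≋ con 0ℚ
  coordinates-0 f p with l , f≋l ← monomials-span f = ≋-trans f≋l (combination-0 monomial l λ m →
    trans (sym (coordinate-monomials (δ m) l)) (trans (sym (coordinate-≋ (δ m) f≋l)) (p m)))

-- Cancelling the Vandermonde product

vec-ext : ∀ {A : Set} {n} {v w : Vec A n} → lookup v ≗ lookup w → v ≡ w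
vec-ext {v = []}    {[]}    p = refl
vec-ext {v = _ ∷ _} {_ ∷ _} p = cong₂ _∷_ (p zero) (vec-ext (p ∘ suc))

-- With c = 0 the operator of var i is the i-th shift, so that of var i ⊕ ⊖ var j is onto;
-- and operators commute, so f ⊗ g ≋ 0 with g onto makes all coordinates of f vanish.
module Cancellation {d : ℕ} where
  open Coordinates {d} (λ _ → 0ℚ) (λ _ → 1ℚ) (λ v →
    trans (ℚ.*-identityˡ _) (trans (cong (1ℚ +_) (sum-replicate-zero d)) (ℚ.+-identityʳ 1ℚ)))
  open Bialternant (polyRing (Fin d)) using (product; vandermonde)

  -- Surjectivity of the transposed operator, dual to injectivity of multiplication by f.
  Onto : Poly (Fin d) → Set
  Onto f = ∀ ψ → ∃ λ φ → act f φ ≗ ψ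

  onto-⊗ : ∀ {f g} → Onto f → Onto g → Onto (f ⊗ g)
  onto-⊗ {f} of og ψ with χ , p ← of ψ with φ , q ← og χ = φ , λ v → trans (act-cong f q v) (p v)

  onto-1 : Onto (con 1ℚ)
  onto-1 ψ = ψ , λ v → ℚ.*-identityˡ (ψ v)

  -- The equation φ(v+εᵢ) - φ(v+εⱼ) = ψ(v) is solved by recursion on the i-th entry, starting from φ
  -- = 0 where that entry is 0; the shift by εⱼ keeps the entry since i ≠ j.
  onto-var-var : ∀ {i j} → i ≢ j → Onto (var i ⊕ ⊖ var j)
  onto-var-var {i} {j} i≢j ψ = φ , λ v → let a = go (lookup v i) (increment j v) in begin
    act (var i ⊕ ⊖ var j) φ v
      ≡⟨ solve 5 (λ x y z t o → (x :+ :- (o :* z)) :+ t :* (y :+ :- (o :* z)) := (x :+ t :* y) :- o :* (z :+ t :* z)) refl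
           (φ (increment i v)) (φ (increment j v)) (Z φ v) (- 1ℚ) 0ℚ ⟩
    φ (increment i v) + - 1ℚ * φ (increment j v) - 0ℚ * (Z φ v + - 1ℚ * Z φ v)
      ≡⟨ cong₂ (λ y z → φ (increment i v) + y - z) (-1*≡- (φ (increment j v)))
           (ℚ.*-zeroˡ (Z φ v + - 1ℚ * Z φ v)) ⟩
    φ (increment i v) - φ (increment j v) + 0ℚ
      ≡⟨ ℚ.+-identityʳ _ ⟩
    φ (increment i v) - φ (increment j v)
      ≡⟨ cong₂ _-_ (shiftᵢ v) (cong (λ k → go k (increment j v)) (lookup∘updateAt′ i j i≢j v)) ⟩
    (ψ v + a) - a
      ≡⟨ solve 2 (λ p q → (p :+ q) :- q := p) refl (ψ v) a ⟩
    ψ v ∎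
    where
    open ≡-Reasoning
    -- The number is the i-th entry of the vector, passed separately so that the recursion is
    -- structural.
    go : ℕ → Vec ℕ d → ℚ
    go zero    v = 0ℚ
    go (suc k) v = ψ (updateAt v i ℕ.pred) + go k (increment j (updateAt v i ℕ.pred))
    φ : Vec ℕ d → ℚ
    φ v = go (lookup v i) v
    shiftᵢ : ∀ v → φ (increment i v) ≡ ψ v + go (lookup v i) (increment j v)
    shiftᵢ v = trans (cong (λ k → go k (increment i v)) (lookup∘updateAt i v))
      (cong (λ v′ → ψ v′ + go (lookup v i) (increment j v′))
        (trans (updateAt-updateAt-local i {h = λ x → x} v refl) (updateAt-id-local i v refl)))

  onto-product : ∀ {n} {t : Fin n → Poly (Fin d)} → (∀ i → Onto (t i)) → Onto (product t)
  onto-product {zero}      o = onto-1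
  onto-product {suc n} {t} o = onto-⊗ {t zero} {product (t ∘ suc)} (o zero) (onto-product (o ∘ suc))

  -- The injective family ι lets the induction drop the first variable while the polynomial ring
  -- stays fixed.
  onto-vandermonde : ∀ {n} {ι : Fin n → Fin d} → Injective _≡_ _≡_ ι → Onto (vandermonde (var ∘ ι))
  onto-vandermonde {zero}      inj = onto-1
  onto-vandermonde {suc n} {ι} inj = onto-⊗ {product λ j → var (ι zero) ⊕ ⊖ var (ι (suc j))} {vandermonde (var ∘ ι ∘ suc)}
    (onto-product {t = λ j → var (ι zero) ⊕ ⊖ var (ι (suc j))} λ j → onto-var-var (Fin.0≢1+n ∘ inj))
    (onto-vandermonde (Fin.suc-injective ∘ inj))

  onto-cancel : ∀ {f g} → Onto g → f ⊗ g ≋ con 0ℚ → f ≋ con 0ℚ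
  onto-cancel {f} {g} og p = coordinates-0 f λ m → let φ , q = og (δ m) in begin
    coordinate (δ m) f        ≡⟨ act-cong f q origin ⟨
    coordinate φ (f ⊗ g)      ≡⟨ coordinate-≋ φ p ⟩
    0ℚ * φ origin             ≡⟨ ℚ.*-zeroˡ (φ origin) ⟩
    0ℚ                        ∎
    where open ≡-Reasoning

  vandermonde-cancel : ∀ {f} → f ⊗ vandermonde var ≋ con 0ℚ → f ≋ con 0ℚ
  vandermonde-cancel = onto-cancel {g = vandermonde var} (onto-vandermonde {ι = λ i → i} (λ p → p))

open Cancellation public using (vandermonde-cancel)

-- Coefficients of alternants

sum-0 : ∀ {n} {t : Fin n → ℚ} → (∀ i → t i ≡ 0ℚ) → sum t ≡ 0ℚ
sum-0 {zero}  p = refl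
sum-0 {suc n} p = trans (cong₂ _+_ (p zero) (sum-0 (p ∘ suc))) (ℚ.+-identityˡ 0ℚ)

Decreasing : ∀ {n} → (Fin n → ℕ) → Set
Decreasing e = ∀ {i j} → i Fin.< j → e j ℕ.< e i

punchIn-mono-< : ∀ {n} k {i j : Fin n} → i Fin.< j → punchIn k i Fin.< punchIn k j
punchIn-mono-< k {i} {j} i<j = Fin.≤∧≢⇒< (Fin.punchIn-mono-≤ k i j (ℕ.<⇒≤ i<j))
  (Fin.<⇒≢ i<j ∘ Fin.punchIn-injective k i j)

module Alternants {d : ℕ} (c : ℕ → ℚ) (κ : Vec ℕ d → ℚ)
  (κ-inverse : ∀ v → κ v * (1ℚ + total c v) ≡ 1ℚ) where

  open Coordinates c κ κ-inverse public
  open Bialternant (polyRing (Fin d)) using (det)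
  open CommutativeRing (polyRing (Fin d)) using (semiring)
  open import Algebra.Properties.Semiring.Exp semiring using (_^_)

  minor : ∀ {k} → (Fin k → ℕ) → (Fin k → Fin d) → Poly (Fin d)
  minor e ι = det λ i j → power (e i) (ι j)

  alternant : (Fin d → ℕ) → Poly (Fin d)
  alternant e = minor e λ j → j

  private
    act-sign-0 : ∀ n {φ v} → φ v ≡ 0ℚ → act ((⊖ con 1ℚ) ^ n) φ v ≡ 0ℚ
    act-sign-0 zero    p = trans (cong (1ℚ *_) p) (ℚ.*-zeroʳ 1ℚ)
    act-sign-0 (suc n) p = cong (λ x → - 1ℚ * (1ℚ * x)) (act-sign-0 n p)

    -- Expanding along a column ι j records the exponent chosen for it in the entry
    -- ι j of v; the minor of the columns ι has coefficient 1 or 0 according to whether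
    -- the v completed by the decreasing e is m.
    module _ {k} (e : Fin (suc k) → ℕ) {ι : Fin (suc k) → Fin d} (ι-inj : Injective _≡_ _≡_ ι)
             (m v : Vec ℕ d) (v-0 : ∀ j → lookup v (ι j) ≡ 0) where

      fill : Fin (suc k) → Vec ℕ d
      fill i = v [ ι zero ]≔ e i

      fill-≢ : ∀ i {r} → ι zero ≢ r → lookup (fill i) r ≡ lookup v r
      fill-≢ i ι₀≢r = lookup∘updateAt′ _ (ι zero) (ι₀≢r ∘ sym) v

      fill-≡ : ∀ i → lookup (fill i) (ι zero) ≡ e i
      fill-≡ i = lookup∘updateAt (ι zero) v

      fill-0 : ∀ i j → lookup (fill i) (ι (suc j)) ≡ 0
      fill-0 i j = trans (fill-≢ i (Fin.0≢1+n ∘ ι-inj)) (v-0 (suc j))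

      term : Fin (suc k) → ℚ
      term i = act ((⊖ con 1ℚ) ^ toℕ i) (act (power (e i) (ι zero)) (act (minor (e ∘ punchIn i) (ι ∘ suc)) (δ m))) v

      expansion : act (minor e ι) (δ m) v ≡ sum term
      expansion = act-∑ (λ i → (⊖ con 1ℚ) ^ toℕ i ⊗ (power (e i) (ι zero) ⊗ minor (e ∘ punchIn i) (ι ∘ suc))) (δ m) v

      fill-column : ∀ i → act (power (e i) (ι zero)) (act (minor (e ∘ punchIn i) (ι ∘ suc)) (δ m)) v ≡
                          act (minor (e ∘ punchIn i) (ι ∘ suc)) (δ m) (fill i)
      fill-column i = act-power (e i) (ι zero) _ v (v-0 zero)

      term-0 : ∀ i → act (minor (e ∘ punchIn i) (ι ∘ suc)) (δ m) (fill i) ≡ 0ℚ → term i ≡ 0ℚ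
      term-0 i p = act-sign-0 (toℕ i) (trans (fill-column i) p)

    -- No remaining column writes to the entry r, so its disagreement with m survives to the end,
    -- where `δ m` vanishes.
    mismatch-outside : ∀ {k} (e : Fin k → ℕ) {ι : Fin k → Fin d} → Injective _≡_ _≡_ ι →
      ∀ m v → (∀ j → lookup v (ι j) ≡ 0) → ∀ r → (∀ j → ι j ≢ r) → lookup v r ≢ lookup m r →
      act (minor e ι) (δ m) v ≡ 0ℚ
    mismatch-outside {zero}  e inj m v v-0 r r∉ι vᵣ≢mᵣ =
      trans (ℚ.*-identityˡ (δ m v)) (δ-≢ {m = m} {v} λ v≡m → vᵣ≢mᵣ (cong (λ v → lookup v r) v≡m))
    mismatch-outside {suc k} e inj m v v-0 r r∉ι vᵣ≢mᵣ = trans (expansion e inj m v v-0) (sum-0 λ i →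
      term-0 e inj m v v-0 i (mismatch-outside (e ∘ punchIn i) (Fin.suc-injective ∘ inj) m _ (fill-0 e inj m v v-0 i)
        r (r∉ι ∘ suc) (vᵣ≢mᵣ ∘ trans (sym (fill-≢ e inj m v v-0 i (r∉ι zero))))))

    mismatch-first : ∀ {k} (e : Fin (suc k) → ℕ) {ι : Fin (suc k) → Fin d} (inj : Injective _≡_ _≡_ ι) →
      ∀ m v (v-0 : ∀ j → lookup v (ι j) ≡ 0) i → e i ≢ lookup m (ι zero) → term e inj m v v-0 i ≡ 0ℚ
    mismatch-first e {ι} inj m v v-0 i p = term-0 e inj m v v-0 i
      (mismatch-outside (e ∘ punchIn i) (Fin.suc-injective ∘ inj) m _ (fill-0 e inj m v v-0 i)
        (ι zero) (λ j → Fin.0≢1+n ∘ sym ∘ inj) (p ∘ trans (sym (fill-≡ e inj m v v-0 i))))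

    -- Every term of the expansion vanishes: either the chosen row disagrees with m in the first
    -- column, or a disagreement is left for the smaller minor.
    mismatch : ∀ {k} {e : Fin k → ℕ} → Decreasing e → {ι : Fin k → Fin d} → Injective _≡_ _≡_ ι →
      ∀ m v → Decreasing (lookup m ∘ ι) → (∀ j → lookup v (ι j) ≡ 0) →
      ∀ j → e j ≢ lookup m (ι j) → act (minor e ι) (δ m) v ≡ 0ℚ
    mismatch {suc k} {e} e↓ {ι} inj m v m↓ v-0 j eⱼ≢mⱼ = trans (expansion e inj m v v-0) (sum-0 zero-term)
      where
      next : ∀ i j → e (punchIn i j) ≢ lookup m (ι (suc j)) → term e inj m v v-0 i ≡ 0ℚ
      next i j p = term-0 e inj m v v-0 i (mismatch (e↓ ∘ punchIn-mono-< i) (Fin.suc-injective ∘ inj) m _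
        (m↓ ∘ ℕ.s<s) (fill-0 e inj m v v-0 i) j p)

      first : ∀ j → e j ≢ lookup m (ι j) → e zero ≡ lookup m (ι zero) → term e inj m v v-0 zero ≡ 0ℚ
      first zero    e₀≢m₀ e₀≡m₀ = ⊥-elim (e₀≢m₀ e₀≡m₀)
      first (suc j) eⱼ≢mⱼ e₀≡m₀ = next zero j eⱼ≢mⱼ

      zero-term : ∀ i → term e inj m v v-0 i ≡ 0ℚ
      zero-term i with e i ℕ.≟ lookup m (ι zero)
      zero-term i                | no eᵢ≢m₀  = mismatch-first e inj m v v-0 i eᵢ≢m₀
      zero-term zero             | yes e₀≡m₀ = first j eⱼ≢mⱼ e₀≡m₀
      -- Row 0 is still available and has e₀ > eᵢ = m₀ > m₁, a disagreement in the next column.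
      zero-term (suc {suc _} i)  | yes eᵢ≡m₀ = next (suc i) zero
        (ℕ.>⇒≢ (ℕ.<-trans (m↓ ℕ.z<s) (ℕ.≤-<-trans (ℕ.≤-reflexive (sym eᵢ≡m₀)) (e↓ ℕ.z<s))))

    -- Only the diagonal product survives: by strict decrease the top row alone has the exponent
    -- required in the first column, and its sign is positive.
    match : ∀ {k} {e : Fin k → ℕ} → Decreasing e → {ι : Fin k → Fin d} → Injective _≡_ _≡_ ι →
      ∀ m v → (∀ j → lookup v (ι j) ≡ 0) → (∀ j → e j ≡ lookup m (ι j)) →
      (∀ r → (∀ j → ι j ≢ r) → lookup v r ≡ lookup m r) → act (minor e ι) (δ m) v ≡ 1ℚ
    match {zero}      e↓ inj m v v-0 p q = trans (ℚ.*-identityˡ (δ m v)) (δ-≡ {m = m} {v} (vec-ext λ r → q r λ ()))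
    match {suc k} {e} e↓ {ι} inj m v v-0 p q = begin
      act (minor e ι) (δ m) v
        ≡⟨ expansion e inj m v v-0 ⟩
      term e inj m v v-0 zero + sum (term e inj m v v-0 ∘ suc)
        ≡⟨ cong₂ _+_ (trans (ℚ.*-identityˡ _) (fill-column e inj m v v-0 zero)) (sum-0 λ i →
             mismatch-first e inj m v v-0 (suc i) (ℕ.<⇒≢ (e↓ (ℕ.z<s {toℕ i})) ∘ λ eᵢ≡m₀ → trans eᵢ≡m₀ (sym (p zero)))) ⟩
      act (minor (e ∘ suc) (ι ∘ suc)) (δ m) (fill e inj m v v-0 zero) + 0ℚ
        ≡⟨ ℚ.+-identityʳ _ ⟩
      act (minor (e ∘ suc) (ι ∘ suc)) (δ m) (fill e inj m v v-0 zero)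
        ≡⟨ match (e↓ ∘ ℕ.s<s) (Fin.suc-injective ∘ inj) m _ (fill-0 e inj m v v-0 zero) (p ∘ suc) agree ⟩
      1ℚ ∎
      where
      open ≡-Reasoning
      agree : ∀ r → (∀ j → ι (suc j) ≢ r) → lookup (fill e inj m v v-0 zero) r ≡ lookup m r
      agree r r∉ι with ι zero Fin.≟ r
      ... | yes refl = trans (fill-≡ e inj m v v-0 zero) (p zero)
      ... | no ι₀≢r  = trans (fill-≢ e inj m v v-0 zero ι₀≢r) (q r λ where
        zero    → ι₀≢r
        (suc j) → r∉ι j)

  linked⇒decreasing : ∀ {n} {v : Vec ℕ n} → Linked ℕ._>_ v → Decreasing (lookup v)
  linked⇒decreasing l = lookup⁺ (λ p q → ℕ.<-trans q p) l

  coordinate-alternant : ∀ {m v} → Linked ℕ._>_ m → Linked ℕ._>_ v →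
                         coordinate (δ m) (alternant (lookup v)) ≡ δ m v
  coordinate-alternant {m} {v} m↓ v↓ with v ≟ᵥ m
  ... | yes refl = match (linked⇒decreasing v↓) (λ p → p) m origin (λ j → lookup-replicate j 0) (λ _ → refl)
                     (λ r r∉ → ⊥-elim (r∉ r refl))
  ... | no v≢m with j , p ← Fin.¬∀⟶∃¬ _ _ (λ j → lookup v j ℕ.≟ lookup m j) (v≢m ∘ vec-ext) =
    mismatch (linked⇒decreasing v↓) (λ p → p) m origin (linked⇒decreasing m↓) (λ j → lookup-replicate j 0) j p

-- Symmetry

module _ {V W : Set} where

  substitute-cong : ∀ {σ τ : V → Poly W} → σ ≗ τ → substitute σ ≗ substitute τ
  substitute-cong p (con k) = refl
  substitute-cong p (var i) = p i
  substitute-cong p (f ⊕ g) = cong₂ _⊕_ (substitute-cong p f) (substitute-cong p g)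
  substitute-cong p (f ⊗ g) = cong₂ _⊗_ (substitute-cong p f) (substitute-cong p g)

  substitute-∘ : ∀ {U : Set} (σ : V → Poly W) (τ : U → Poly V) f →
                 substitute σ (substitute τ f) ≡ substitute (substitute σ ∘ τ) f
  substitute-∘ σ τ (con k) = refl
  substitute-∘ σ τ (var i) = refl
  substitute-∘ σ τ (f ⊕ g) = cong₂ _⊕_ (substitute-∘ σ τ f) (substitute-∘ σ τ g)
  substitute-∘ σ τ (f ⊗ g) = cong₂ _⊗_ (substitute-∘ σ τ f) (substitute-∘ σ τ g)

permuted : ∀ {d} → Permutation′ d → Fin d → Poly (Fin d)
permuted π i = var (π ⟨$⟩ʳ i)

rename : ∀ {d} → Permutation′ d → Poly (Fin d) → Poly (Fin d)
rename π = substitute (permuted π)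

double-0 : ∀ {x} → x ≡ - 1ℚ * x → x ≡ 0ℚ
double-0 {x} p = begin
  x                    ≡⟨ ℚ.*-identityˡ x ⟨
  -- ½ + ½ evaluates to 1ℚ.
  (½ + ½) * x          ≡⟨ solve 2 (λ h x → (h :+ h) :* x := h :* (x :+ x)) refl ½ x ⟩
  ½ * (x + x)          ≡⟨ cong (λ y → ½ * (x + y)) (trans p (-1*≡- x)) ⟩
  ½ * (x - x)          ≡⟨ cong (½ *_) (ℚ.+-inverseʳ x) ⟩
  ½ * 0ℚ               ≡⟨ ℚ.*-zeroʳ ½ ⟩
  0ℚ                   ∎
  where open ≡-Reasoning

module Symmetry {d : ℕ} (c : ℕ → ℚ) (κ : Vec ℕ d → ℚ)
  (κ-inverse : ∀ v → κ v * (1ℚ + total c v) ≡ 1ℚ) where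

  open Alternants c κ κ-inverse public
  open Bialternant (polyRing (Fin d)) using (det; det-cong)
  open CommutativeRing (polyRing (Fin d)) using (*-congˡ; reflexive; +-commutativeMonoid; *-commutativeMonoid)
  open import Algebra.Properties.CommutativeMonoid.Sum *-commutativeMonoid
    using () renaming (sum-cong-≋ to product-cong)
  open import Algebra.Properties.CommutativeMonoid.Sum +-commutativeMonoid
    using () renaming (sum-permute to ∑-permute)

  rename-twist : ∀ π l → rename π (twist l) ≋ twist l
  rename-twist π l = *-congˡ (≋-trans (reflexive (substitute-sum (permuted π) {d} var)) (≋-sym (∑-permute {d} {d} var π)))

  rename-power : ∀ π p i → rename π (power p i) ≋ power p (π ⟨$⟩ʳ i)
  rename-power π p i = ≋-trans
    (reflexive (substitute-factorialPower (permuted π) twist (var i) p))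
    (product-cong {p} λ l → ⊕-cong ≋-refl (*-congˡ (rename-twist π (toℕ l))))

  rename-alternant : ∀ π e → rename π (alternant e) ≋ det (λ i j → power (e i) (π ⟨$⟩ʳ j))
  rename-alternant π e = ≋-trans
    (reflexive (substitute-det (permuted π) λ i j → power (e i) j))
    (det-cong λ i j → rename-power π (e i) j)

module AdjacentSymmetry {n : ℕ} (c : ℕ → ℚ) (κ : Vec ℕ (suc n) → ℚ)
  (κ-inverse : ∀ v → κ v * (1ℚ + total c v) ≡ 1ℚ) where

  open Symmetry c κ κ-inverse public
  open Alternation {Fin (suc n)}
  open Bialternant (polyRing (Fin (suc n))) using (product; vandermonde)
  open CommutativeRing (polyRing (Fin (suc n))) using (setoid; *-congˡ; reflexive; *-commutativeMonoid; -‿cong; ring)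
  open import Algebra.Properties.CommutativeMonoid.Sum *-commutativeMonoid
    using () renaming (sum-permute to product-permute; sum-cong-≋ to product-cong)
  open import Relation.Binary.Reasoning.Setoid setoid

  τ : Fin n → Poly (Fin (suc n)) → Poly (Fin (suc n))
  τ i = rename (adjacent i)

  rename-monomial : ∀ i v → τ i (monomial v) ≋ monomial (swapAt i v)
  rename-monomial i v = begin
    τ i (monomial v)
      ≈⟨ reflexive (substitute-product (permuted (adjacent i)) λ j → power (lookup v j) j) ⟩
    product (λ j → τ i (power (lookup v j) j))
      ≈⟨ product-cong (λ j → rename-power (adjacent i) (lookup v j) j) ⟩
    product (λ j → power (lookup v j) (adjacent i ⟨$⟩ʳ j))
      -- Reindexing by the involution moves the transposition from the variables to the exponents.
      ≈⟨ product-permute (λ j → power (lookup v j) (adjacent i ⟨$⟩ʳ j)) (adjacent i) ⟩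
    product (λ j → power (lookup v (adjacent i ⟨$⟩ʳ j)) (adjacent i ⟨$⟩ʳ (adjacent i ⟨$⟩ʳ j)))
      ≈⟨ product-cong {suc n} (λ j → reflexive (cong₂ power (sym (lookup-swapAt i v j)) (adjacent-involutive i j))) ⟩
    monomial (swapAt i v) ∎

  δ-swapAt : ∀ i m v → δ m (swapAt i v) ≡ δ (swapAt i m) v
  δ-swapAt i m v with v ≟ᵥ swapAt i m
  ... | yes refl   = δ-≡ {suc n} {m = m} {swapAt i (swapAt i m)} (swapAt-involutive i m)
  ... | no v≢swapm = δ-≢ {m = m} {swapAt i v} λ swapv≡m →
    v≢swapm (trans (sym (swapAt-involutive i v)) (cong (swapAt i) swapv≡m))

  rename-combination : ∀ i l → τ i (combination monomial l) ≋ combination (monomial ∘ swapAt i) l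
  rename-combination i []            = ≋-refl
  rename-combination i ((k , v) ∷ l) = ⊕-cong (*-congˡ (rename-monomial i v)) (rename-combination i l)

  -- By linearity this is checked on the Nᵥ, which the transposition permutes.
  coordinate-rename : ∀ i m f → coordinate (δ m) (τ i f) ≡ coordinate (δ (swapAt i m)) f
  coordinate-rename i m f with l , f≋l ← monomials-span f =
    trans (coordinate-≋ (δ m) (≋-trans (substitute-≋ (permuted (adjacent i)) f≋l) (rename-combination i l)))
    (trans (coordinate-combination (monomial ∘ swapAt i) {δ m} {δ (swapAt i m)}
             (λ v → trans (coordinate-monomial (swapAt i v) (δ m)) (δ-swapAt i m v)) l)
    (trans (sym (coordinate-monomials (δ (swapAt i m)) l))
      (sym (coordinate-≋ (δ (swapAt i m)) f≋l))))

  -- The coordinates of f change sign under swaps of m, hence vanish where neighbouring entries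
  -- agree; sorting m then reaches the strictly decreasing case.
  alternating-0 : ∀ f → (∀ i → τ i f ≋ ⊖ f) →
                  (∀ m → Linked _>_ m → coordinate (δ m) f ≡ 0ℚ) → f ≋ con 0ℚ
  alternating-0 f alt f-0 = coordinates-0 f (bubbleSort closed f-0)
    where
    coordinate-swapAt : ∀ i m → coordinate (δ (swapAt i m)) f ≡ - 1ℚ * coordinate (δ m) f
    coordinate-swapAt i m = trans (sym (coordinate-rename i m f)) (coordinate-≋ (δ m) (alt i))

    closed : SwapClosed (λ m → coordinate (δ m) f ≡ 0ℚ)
    closed .SwapClosed.swapped i m p =
      trans (cong (λ v → coordinate (δ v) f) (sym (swapAt-involutive i m)))
            (trans (coordinate-swapAt i (swapAt i m)) (cong (- 1ℚ *_) p))
    closed .SwapClosed.fixed i m p =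
      double-0 (trans (cong (λ v → coordinate (δ v) f) (sym p)) (coordinate-swapAt i m))

  alternant-alternating : ∀ i e → τ i (alternant e) ≋ ⊖ alternant e
  alternant-alternating i e =
    ≋-trans (rename-alternant (adjacent i) e) (det-adjacent i λ r j → power (e r) j)

  V : Poly (Fin (suc n))
  V = vandermonde var

  V-alternating : ∀ i → τ i V ≋ ⊖ V
  V-alternating i = ≋-trans (reflexive (substitute-vandermonde (permuted (adjacent i)) {suc n} var)) (vandermonde-adjacent {n} i var)

  open import Algebra.Properties.Ring ring using (-‿distribʳ-*; -‿involutive; x∙y⁻¹≈ε⇒x≈y; [y-z]x≈yx-zx)

  V-cancel : ∀ {f g} → f ⊗ V ≋ g ⊗ V → f ≋ g
  V-cancel {f} {g} p = x∙y⁻¹≈ε⇒x≈y f g (vandermonde-cancel (begin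
    (f ⊕ ⊖ g) ⊗ V       ≈⟨ [y-z]x≈yx-zx V f g ⟩
    f ⊗ V ⊕ ⊖ (g ⊗ V)   ≈⟨ ⊕-cong p ≋-refl ⟩
    g ⊗ V ⊕ ⊖ (g ⊗ V)   ≈⟨ CommutativeRing.-‿inverseʳ (polyRing (Fin (suc n))) (g ⊗ V) ⟩
    con 0ℚ              ∎))

  -- The signs of g and V cancel, and V can be cancelled as a factor.
  symmetric-quotient : ∀ f g i → f ⊗ V ≋ g → τ i g ≋ ⊖ g → τ i f ≋ f
  symmetric-quotient f g i fV≋g alt = V-cancel (begin
    τ i f ⊗ V            ≈⟨ -‿involutive _ ⟨
    ⊖ ⊖ (τ i f ⊗ V)      ≈⟨ -‿cong (-‿distribʳ-* _ _) ⟩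
    ⊖ (τ i f ⊗ ⊖ V)      ≈⟨ -‿cong (*-congˡ (V-alternating i)) ⟨
    ⊖ (τ i (f ⊗ V))      ≈⟨ -‿cong (substitute-≋ (permuted (adjacent i)) fV≋g) ⟩
    ⊖ (τ i g)            ≈⟨ -‿cong alt ⟩
    ⊖ ⊖ g                ≈⟨ -‿involutive _ ⟩
    g                    ≈⟨ fV≋g ⟨
    f ⊗ V                ∎)

  symmetric-0 : ∀ f → (∀ i → τ i f ≋ f) →
                (∀ m → Linked _>_ m → coordinate (δ m) (f ⊗ V) ≡ 0ℚ) → f ≋ con 0ℚ
  symmetric-0 f sym-f p = vandermonde-cancel (alternating-0 (f ⊗ V)
    (λ i → ≋-trans (⊗-cong (sym-f i) (V-alternating i)) (≋-sym (-‿distribʳ-* f V))) p)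

adjacent⇒symmetric : ∀ {n} (f : Poly (Fin (suc n))) → (∀ i → rename (adjacent i) f ≋ f) → IsSymmetric f
adjacent⇒symmetric {n} f p = adjacent-generate closed (reflexive (identity f))
  where
  open CommutativeRing (polyRing (Fin (suc n))) using (reflexive)

  identity : ∀ f → substitute var f ≡ f
  identity (con k) = refl
  identity (var i) = refl
  identity (f ⊕ g) = cong₂ _⊕_ (identity f) (identity g)
  identity (f ⊗ g) = cong₂ _⊗_ (identity f) (identity g)

  closed : AdjacentClosed (λ ρ → substitute (var ∘ ρ) f ≋ f)
  closed .AdjacentClosed.resp ρ≗σ q = ≋-trans (reflexive (sym (substitute-cong (cong var ∘ ρ≗σ) f))) q
  -- Renaming along ρ after `adjacent i` applies the transposition first, and it fixes f.
  closed .AdjacentClosed.step {ρ} i q = ≋-trans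
    (reflexive (sym (substitute-∘ (var ∘ ρ) (permuted (adjacent i)) f)))
    (≋-trans (substitute-≋ (var ∘ ρ) (p i)) q)

-- Partitions and strictly decreasing exponents

module _ {d : ℕ} where

  exponents : Partition d → Vec ℕ d
  exponents μ = Vec.tabulate λ i → lookup (parts μ) i ℕ.+ (d ∸ suc (toℕ i))

  lookup-exponents : ∀ μ i → lookup (exponents μ) i ≡ lookup (parts μ) i ℕ.+ (d ∸ suc (toℕ i))
  lookup-exponents μ = lookup∘tabulate _

  bar∸1 : ∀ μ i → bar μ i ∸ 1 ≡ lookup (exponents μ) i
  bar∸1 μ i = begin
    lookup (parts μ) i ℕ.+ (suc d ∸ suc (toℕ i)) ∸ 1
      -- Truncation does no harm: i < d, so at least 1 remains to subtract from.
      ≡⟨ ℕ.+-∸-assoc (lookup (parts μ) i) (ℕ.m<n⇒0<n∸m (Fin.toℕ<n i)) ⟩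
    lookup (parts μ) i ℕ.+ (d ∸ toℕ i ∸ 1)
      ≡⟨ cong (lookup (parts μ) i ℕ.+_) (trans (ℕ.∸-+-assoc d (toℕ i) 1) (cong (d ∸_) (ℕ.+-comm (toℕ i) 1))) ⟩
    lookup (parts μ) i ℕ.+ (d ∸ suc (toℕ i))
      ≡⟨ lookup-exponents μ i ⟨
    lookup (exponents μ) i ∎
    where open ≡-Reasoning

  exponents-injective : ∀ {μ ν} → exponents μ ≡ exponents ν → μ ≡ ν
  exponents-injective {μ} {ν} p = partition-≡ (vec-ext λ i → ℕ.+-cancelʳ-≡ (d ∸ suc (toℕ i)) _ _
    (trans (sym (lookup-exponents μ i)) (trans (cong (λ v → lookup v i) p) (lookup-exponents ν i))))
    where
    partition-≡ : ∀ {μ ν : Partition d} → parts μ ≡ parts ν → μ ≡ ν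
    partition-≡ refl = refl

tabulate-linked : ∀ {n} {f : Fin n → ℕ} → Decreasing f → Linked _>_ (Vec.tabulate f)
tabulate-linked {zero}        f↓ = []
tabulate-linked {suc zero}    f↓ = [-]
tabulate-linked {suc (suc n)} f↓ = f↓ ℕ.z<s ∷ tabulate-linked (f↓ ∘ ℕ.s<s)

exponents-decreasing : ∀ {d} (μ : Partition d) → Linked _>_ (exponents μ)
exponents-decreasing {d} record { parts = v ; decreasing = v≥ } = tabulate-linked λ {i} {j} i<j →
  -- The irrelevant proof that the parts decrease is recovered from decidability.
  ℕ.+-mono-≤-< (lookup⁺ (λ p q → ℕ.≤-trans q p) (recompute (linked? ℕ._≥?_ v) v≥) i<j)
               (ℕ.∸-monoʳ-< (ℕ.s<s i<j) (Fin.toℕ<n j))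

-- Subtracts (n-1, ..., 0), inverting `exponents`; on strictly decreasing vectors `decreasing-head`
-- keeps the subtraction from truncating.
staircase : ∀ {n} → Vec ℕ n → Vec ℕ n
staircase             []      = []
staircase {n = suc n} (x ∷ v) = x ∸ n ∷ staircase v

staircase-≥ : ∀ {n} {v : Vec ℕ n} → Linked _>_ v → Linked _≥_ (staircase v)
staircase-≥                          []        = []
staircase-≥                          [-]       = [-]
staircase-≥ {suc (suc n)} {_ ∷ _ ∷ _} (x>y ∷ l) = ℕ.∸-monoˡ-≤ (suc n) x>y ∷ staircase-≥ l

decreasing-head : ∀ {n x} {v : Vec ℕ n} → Linked _>_ (x ∷ v) → n ℕ.≤ x
decreasing-head             [-]       = ℕ.z≤n
decreasing-head {v = _ ∷ _} (x>y ∷ l) = ℕ.≤-<-trans (decreasing-head l) x>y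

lookup-staircase : ∀ {n} {v : Vec ℕ n} → Linked _>_ v → ∀ i →
                   lookup (staircase v) i ℕ.+ (n ∸ suc (toℕ i)) ≡ lookup v i
lookup-staircase {v = _ ∷ _}     l       zero    = ℕ.m∸n+n≡m (decreasing-head l)
lookup-staircase {v = _ ∷ _ ∷ _} (_ ∷ l) (suc i) = lookup-staircase l i

fromDecreasing : ∀ {d} (v : Vec ℕ d) → Linked _>_ v → Partition d
fromDecreasing v l = record { parts = staircase v ; decreasing = staircase-≥ l }

exponents-fromDecreasing : ∀ {d} {v : Vec ℕ d} (l : Linked _>_ v) → exponents (fromDecreasing v l) ≡ v
exponents-fromDecreasing {v = v} l = vec-ext λ i → trans (lookup-exponents (fromDecreasing v l) i) (lookup-staircase l i)

decreasing? : ∀ {d} (v : Vec ℕ d) → Dec (Linked _>_ v)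
decreasing? = linked? ℕ._>?_

-- From an expansion of an alternating polynomial in the Nᵥ, this keeps the terms that determine it,
-- indexed by partitions.
select : ∀ {d} → List (ℚ × Vec ℕ d) → List (ℚ × Partition d)
select []            = []
select ((k , v) ∷ l) with decreasing? v
... | yes v↓ = (k , fromDecreasing v v↓) ∷ select l
... | no _   = select l

-- A discarded v is not strictly decreasing, hence differs from m and contributes 0.
evaluate-select : ∀ {d} {m : Vec ℕ d} → Linked _>_ m → ∀ l →
                  evaluate (δ m ∘ exponents) (select l) ≡ evaluate (δ m) l
evaluate-select         m↓ []            = refl
evaluate-select {m = m} m↓ ((k , v) ∷ l) with decreasing? v
... | yes v↓ = cong₂ (λ w x → k * δ m w + x) (exponents-fromDecreasing v↓) (evaluate-select m↓ l)
... | no ¬v↓ = trans (evaluate-select m↓ l) (trans (sym (ℚ.+-identityˡ _))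
  (cong (_+ evaluate (δ m) l) (sym (trans (cong (k *_) (δ-≢ {m = m} {v} λ where refl → ¬v↓ m↓)) (ℚ.*-zeroʳ k)))))

sum-single : ∀ {n} (i : Fin n) {t : Fin n → ℚ} → (∀ j → j ≢ i → t j ≡ 0ℚ) → sum t ≡ t i
sum-single {suc n} i {t} p = trans (sum-remove {i = i} t)
  (trans (cong (t i +_) (sum-0 λ j → p (punchIn i j) (Fin.punchInᵢ≢i i j))) (ℚ.+-identityʳ (t i)))

-- The basis of quotients of alternants

module Quotients {n : ℕ} (c : ℕ → ℚ) (κ : Vec ℕ (suc n) → ℚ)
  (κ-inverse : ∀ v → κ v * (1ℚ + total c v) ≡ 1ℚ) where

  open AdjacentSymmetry c κ κ-inverse

  -- The equation `S⊗V` determines the family S, as V can be cancelled, and is the form in which the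
  -- twisted Schur polynomials enter.
  module _ (S : Partition (suc n) → Poly (Fin (suc n)))
           (S⊗V : ∀ μ → S μ ⊗ V ≋ alternant (lookup (exponents μ))) where

    private d = suc n

    open Bialternant (polyRing (Fin d)) using () renaming (sum to ∑)
    open CommutativeRing (polyRing (Fin d)) using (*-congˡ; *-congʳ; ring; semiring; zeroˡ)

    S-adjacent : ∀ μ i → τ i (S μ) ≋ S μ
    S-adjacent μ i = symmetric-quotient (S μ) _ i (S⊗V μ) (alternant-alternating i (lookup (exponents μ)))

    coordinate-S⊗V : ∀ {m} → Linked _>_ m → ∀ μ → coordinate (δ m) (S μ ⊗ V) ≡ δ m (exponents μ)
    coordinate-S⊗V {m} m↓ μ = trans (coordinate-≋ (δ m) (S⊗V μ)) (coordinate-alternant m↓ (exponents-decreasing μ))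

    -- Multiply the relation by V and take the coordinate at the exponents of μ j: only the j-th
    -- term survives.
    S-independent : ∀ {k} (μ : Fin k → Partition d) → Injective _≡_ _≡_ μ → (a : Fin k → ℚ) →
                    ∑ (λ j → con (a j) ⊗ S (μ j)) ≋ con 0ℚ → ∀ j → a j ≡ 0ℚ
    S-independent μ inj a p j = trans (sym (trans (sum-single j others) diagonal))
      (trans (sym (act-∑ (λ j → con (a j) ⊗ S (μ j) ⊗ V) (δ m) origin))
      (trans (coordinate-≋ (δ m) (≋-trans (≋-sym (*-distribʳ-sum V λ j → con (a j) ⊗ S (μ j))) (≋-trans (*-congʳ p) (zeroˡ V))))
             (ℚ.*-zeroˡ (δ m origin))))
      where
      open import Algebra.Properties.Semiring.Sum semiring using (*-distribʳ-sum)
      m = exponents (μ j)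
      m↓ = exponents-decreasing (μ j)
      value : ∀ i → coordinate (δ m) (con (a i) ⊗ S (μ i) ⊗ V) ≡ a i * δ m (exponents (μ i))
      value i = cong (a i *_) (coordinate-S⊗V m↓ (μ i))
      others : ∀ i → i ≢ j → coordinate (δ m) (con (a i) ⊗ S (μ i) ⊗ V) ≡ 0ℚ
      others i i≢j = trans (value i) (trans (cong (a i *_) (δ-≢ {m = m} (i≢j ∘ inj ∘ exponents-injective))) (ℚ.*-zeroʳ (a i)))
      diagonal : coordinate (δ m) (con (a j) ⊗ S (μ j) ⊗ V) ≡ a j
      diagonal = trans (value j) (trans (cong (a j *_) (δ-≡ {m = m} refl)) (ℚ.*-identityʳ (a j)))

    combination-S-adjacent : ∀ l i → τ i (combination S l) ≋ combination S l
    combination-S-adjacent []            i = ≋-refl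
    combination-S-adjacent ((k , μ) ∷ l) i = ⊕-cong (*-congˡ (S-adjacent μ i)) (combination-S-adjacent l i)

    combination-⊗V : ∀ l → combination S l ⊗ V ≋ combination (λ μ → S μ ⊗ V) l
    combination-⊗V []            = ⊗-zeroˡ V
    combination-⊗V ((k , μ) ∷ l) = ≋-trans (⊗-distribʳ V _ _) (⊕-cong (⊗-assoc _ _ _) (combination-⊗V l))

    -- The coefficients are those of f V at strictly decreasing exponents. The resulting combination
    -- F of the S μ is symmetric, and (f - F) V has zero coordinates there, so `symmetric-0`
    -- applies.
    S-spanning : ∀ f → (∀ i → τ i f ≋ f) → Spanned S f
    S-spanning f f-sym with l , fV≋l ← monomials-span (f ⊗ V) = select l ,
      x∙y⁻¹≈ε⇒x≈y f F (symmetric-0 (f ⊕ ⊖ F)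
        (λ i → ⊕-cong (f-sym i) (*-congˡ (combination-S-adjacent (select l) i)))
        λ m m↓ → begin
          coordinate (δ m) ((f ⊕ ⊖ F) ⊗ V)
            ≡⟨ coordinate-≋ (δ m) ([y-z]x≈yx-zx V f F) ⟩
          coordinate (δ m) (f ⊗ V) + - 1ℚ * coordinate (δ m) (F ⊗ V)
            ≡⟨ cong₂ (λ x y → x + - 1ℚ * y)
                 (trans (coordinate-≋ (δ m) fV≋l) (coordinate-monomials (δ m) l))
                 (trans (coordinate-≋ (δ m) (combination-⊗V (select l)))
                   (trans (coordinate-combination (λ μ → S μ ⊗ V) (coordinate-S⊗V m↓) (select l)) (evaluate-select m↓ l))) ⟩
          evaluate (δ m) l + - 1ℚ * evaluate (δ m) l
            ≡⟨ cong (evaluate (δ m) l +_) (-1*≡- (evaluate (δ m) l)) ⟩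
          evaluate (δ m) l - evaluate (δ m) l
            ≡⟨ ℚ.+-inverseʳ (evaluate (δ m) l) ⟩
          0ℚ ∎)
      where
      open import Algebra.Properties.Ring ring using (x∙y⁻¹≈ε⇒x≈y; [y-z]x≈yx-zx)
      open ≡-Reasoning
      F = combination S (select l)

    combination-sum : ∀ l → combination S l ≋ ∑ (λ j → con (proj₁ (List.lookup l j)) ⊗ S (proj₂ (List.lookup l j)))
    combination-sum []      = ≋-refl
    combination-sum (x ∷ l) = ⊕-cong ≋-refl (combination-sum l)

    isBasis : IsBasisOf (polyModule (Fin d)) IsSymmetric S
    isBasis = record
      { membership  = λ μ → adjacent⇒symmetric (S μ) (S-adjacent μ)
      ; independent = S-independent
      ; spanning    = λ f f-sym → let l , f≋l = S-spanning f (λ i → f-sym (adjacent i)) in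
          List.length l , proj₂ ∘ List.lookup l , proj₁ ∘ List.lookup l , ≋-trans f≋l (combination-sum l)
      }

-- Twisted Schur polynomials as quotients of alternants

module _ {d : ℕ} (w : ℕ → ℕ) (u : ℕ) .{{_ : NonZero u}} where
  open Bialternant (polyRing (Fin d)) using (vandermonde; det; det-cong; factorialPower) renaming (sum to ∑)
  open CommutativeRing (polyRing (Fin d)) using (setoid; *-congˡ; reflexive)
  open import Relation.Binary.Reasoning.Setoid setoid

  private
    module A = Bialternant (polyRing (Fin d ⊎ ℕ))

    t : ℕ → Poly (Fin d)
    t l = con (- (ℤ.+ w l ℚ./ u)) ⊗ ∑ {d} var

    σ : Fin d ⊎ ℕ → Poly (Fin d)
    σ = [ var , t ]′

    a-matrix : Partition d → Fin d → Fin d → Poly (Fin d ⊎ ℕ)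
    a-matrix μ i j = A.factorialPower (var ∘ inj₂) (var (inj₁ j)) (bar μ i ∸ 1)

    schur-a : ∀ μ → factorialSchur μ ⊗ A.vandermonde (var ∘ inj₁) ≋ A.det (a-matrix μ)
    schur-a μ = proj₂ (A.bialternant (var ∘ inj₂) (var ∘ inj₁) λ i → bar μ i ∸ 1)

  -- The equation returned by `bialternant` holds between polynomials in x and a; substituting for a
  -- preserves it, and fixes the Vandermonde product in x.
  twistedSchur⊗vandermonde : ∀ μ →
    twistedSchur w u μ ⊗ vandermonde var ≋ det (λ i j → factorialPower t (var j) (lookup (exponents μ) i))
  twistedSchur⊗vandermonde μ = begin
    twistedSchur w u μ ⊗ vandermonde var
      ≈⟨ *-congˡ (reflexive (substitute-vandermonde σ {d} (var ∘ inj₁))) ⟨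
    substitute σ (factorialSchur μ ⊗ A.vandermonde (var ∘ inj₁))
      ≈⟨ substitute-≋ σ (schur-a μ) ⟩
    substitute σ (A.det (a-matrix μ))
      ≈⟨ reflexive (substitute-det σ (a-matrix μ)) ⟩
    det (λ i j → substitute σ (a-matrix μ i j))
      ≈⟨ det-cong (λ i j → reflexive (trans
           (substitute-factorialPower σ (var ∘ inj₂) (var (inj₁ j)) (bar μ i ∸ 1))
           (cong (factorialPower t (var j)) (bar∸1 μ i)))) ⟩
    det (λ i j → factorialPower t (var j) (lookup (exponents μ) i)) ∎

-- Invertibility of 1 + Σᵢ c(vᵢ), and the conclusion

module _ {d : ℕ} (c : ℕ → ℚ) (c≥0 : ∀ l → ℚ.NonNegative (c l)) where

  sum-nonNegative : ∀ {k} (t : Fin k → ℚ) → (∀ i → ℚ.NonNegative (t i)) → ℚ.NonNegative (sum t)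
  sum-nonNegative {zero}  t t≥0 = _
  sum-nonNegative {suc k} t t≥0 = ℚ.nonNeg+nonNeg⇒nonNeg
    (t zero) {{t≥0 zero}} (sum (t ∘ suc)) {{sum-nonNegative (t ∘ suc) (t≥0 ∘ suc)}}

  1+total-nonZero : ∀ (v : Vec ℕ d) → ℚ.NonZero (1ℚ + total c v)
  1+total-nonZero v = ℚ.pos⇒nonZero (1ℚ + total c v)
    {{ℚ.pos+nonNeg⇒pos 1ℚ (total c v) {{sum-nonNegative (c ∘ lookup v) (c≥0 ∘ lookup v)}}}}

  reciprocal : Vec ℕ d → ℚ
  reciprocal v = (ℚ.1/ (1ℚ + total c v)) {{1+total-nonZero v}}

  reciprocal-inverse : ∀ v → reciprocal v * (1ℚ + total c v) ≡ 1ℚ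
  reciprocal-inverse v = ℚ.*-inverseˡ (1ℚ + total c v) {{1+total-nonZero v}}

proposition5p3 : (d : ℕ) .{{_ : NonZero d}} (w : ℕ → ℕ) (u : ℕ) .{{_ : NonZero u}} → IsBasisOf (polyModule (Fin d)) IsSymmetric (twistedSchur {d} w u)
proposition5p3 (suc n) w u =
  Quotients.isBasis c (reciprocal c c≥0) (reciprocal-inverse c c≥0)
    (twistedSchur w u) (twistedSchur⊗vandermonde w u)
  where
  -- With this c, `twist l` is by definition the value substituted for a_{l+1}, so the alternants
  -- agree without conversion.
  c : ℕ → ℚ
  c l = ℤ.+ w l ℚ./ u

  c≥0 : ∀ l → ℚ.NonNegative (c l)
  c≥0 l = ℚ.normalize-nonNeg (w l) u
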